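{- Let $n\ge 1$ be an integer. Suppose that the shifted Lonely Runner Conjecture (sLRC) is true for $n$ runners and that the Lonely Vector Property holds for every natural number $\le n$. Let $v_1,\dots,v_n$ be pairwise distinct positive integers with $\gcd(v_1,\dots,v_n)=1$ and $$\sum_{S\subseteq [n]} v_S > \binom{n+1}{2}^{n-1}.$$ Then sLRC is true for the $n+1$ runners with velocities $0,v_1,\dots,v_n$, that is, for every $s_1,\dots,s_n\in\mathbb{R}$ there is some $t\in\mathbb{R}$ such that $\|v_it+s_i\|\ge\frac{1}{n+1}$ for every $1\le i\le n$.
   Context: For $x\in\mathbb{R}$, $\|x\|$ denotes the distance from $x$ to a nearest integer. "sLRC is true for $m+1$ runners" means: for all pairwise distinct positive real numbers $w_1,\dots,w_m$ and all $s_1,\dots,s_m\in\mathbb{R}$ there is some $t\in\mathbb{R}$ with $\|w_it+s_i\|\ge\frac1{m+1}$ for all $1\le i\le m$ (so "for $n$ runners" is the statement with $n-1$ velocities; for zero velocities it is vacuous). Here $[n]=\{1,\dots,n\}$ and, for $S\subseteq[n]$, $v_S:=\gcd(v_i:i\in S)$, with $v_\emptyset=0$. Lonely Vector Property (LVP): for a set $\mathbf P=\{\mathbf p_1,\dots,\mathbf p_k\}\subseteq\mathbb{R}^2$ of $k$ non-zero vectors, not all parallel and no two equal or opposite to one another, let $S_{\mathbf P}$ be the multiset of cardinality $k^2$ given by $$S_{\mathbf P}=\mathbf P\cup\{\mathbf p_i+\mathbf p_j:1\le i<j\le k\}\cup\{\mathbf p_i-\mathbf p_j:1\le i<j\le k\}.$$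 The set $\mathbf P$ satisfies the LVP if $S_{\mathbf P}$ contains a vector that is not parallel to any other vector in the multiset $S_{\mathbf P}$. The LVP holds for a natural number $k$ if every set of $k$ non-zero vectors in $\mathbb{Q}^2$, not all parallel and no two equal or opposite, satisfies the LVP. -}

module Defs where

open import Algebra.Bundles using (CommutativeRing)
open import Axiom.ExcludedMiddle using (ExcludedMiddle)
open import Data.Empty using (⊥-elim)
open import Data.Fin.Base as Fin using (Fin)
open import Data.Fin.Subset using (Subset; inside; outside)
open import Data.Fin.Subset.Properties using (_∈?_)
open import Data.Integer.Base as ℤ using (ℤ; +_; -[1+_])
import Data.Integer.Properties as ℤ
open import Data.List.Base using (List; []; _∷_; _++_; map; foldr; filter; allFin)
open import Data.Nat.Base as ℕ using (ℕ; zero; suc; NonZero)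
open import Data.Nat.GCD using (gcd)
import Data.Nat.Properties as ℕ
open import Data.Product.Base using (∃; _×_; _,_; proj₁; proj₂)
open import Data.Rational.Base as ℚ using (ℚ; 0ℚ)
open import Data.Sum.Base using (_⊎_; inj₁; inj₂)
open import Data.Vec.Base as Vec using ()
open import Function.Base using (_∘_)
open import Function.Definitions using (Injective)
open import Level using (0ℓ)
open import Relation.Binary.Bundles using (TotalOrder)
open import Relation.Binary.Core using (Rel)
open import Relation.Binary.PropositionalEquality.Core as ≡ using (_≡_; _≢_)
open import Relation.Binary.Structures using (IsTotalOrder)
open import Relation.Nullary.Decidable.Core using (yes; no)
open import Relation.Nullary.Negation.Core using (¬_)

-- The real numbers, characterised up to isomorphism as a
-- (Dedekind-)complete ordered field.

record CompleteOrderedField : Set₁ where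
  field
    commutativeRing : CommutativeRing 0ℓ 0ℓ

  open CommutativeRing commutativeRing public

  infix 4 _≤_ _<_

  field
    _≤_          : Rel Carrier 0ℓ
    isTotalOrder : IsTotalOrder _≈_ _≤_
    1≉0          : ¬ 1# ≈ 0#
    inverse      : ∀ x → ¬ x ≈ 0# → ∃ λ y → x * y ≈ 1#
    +-monoˡ-≤    : ∀ z {x y} → x ≤ y → x + z ≤ y + z
    *-nonneg     : ∀ {x y} → 0# ≤ x → 0# ≤ y → 0# ≤ x * y

  UpperBound : (Carrier → Set) → Carrier → Set
  UpperBound P b = ∀ x → P x → x ≤ b

  field
    supremum : ∀ (P : Carrier → Set) → ∃ P → ∃ (UpperBound P) →
               ∃ λ s → UpperBound P s × (∀ b → UpperBound P b → s ≤ b)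

  _<_ : Rel Carrier 0ℓ
  x < y = x ≤ y × ¬ x ≈ y

  totalOrder : TotalOrder 0ℓ 0ℓ 0ℓ
  totalOrder = record { isTotalOrder = isTotalOrder }

-- Excluded middle is used to obtain the
-- Archimedean property, hence a nearest integer, from completeness.

module Real (em : ExcludedMiddle 0ℓ) (R : CompleteOrderedField) where

  open CompleteOrderedField R renaming (Carrier to ℝ) public

  open TotalOrder totalOrder public
    using (total; antisym; ≤-respˡ-≈; ≤-respʳ-≈; poset)
    renaming (refl to ≤-refl; reflexive to ≤-reflexive; trans to ≤-trans)

  open import Algebra.Construct.NaturalChoice.Max totalOrder public
    using (_⊔_; x≤x⊔y; x≤y⊔x; x≤y⇒x⊔y≈y; x≤y⇒y⊔x≈y)
  open import Algebra.Properties.Semiring.Mult semiring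
    using () renaming (_×_ to _·_)
  open import Algebra.Properties.Group +-group
    using (⁻¹-involutive; ⁻¹-anti-homo-//; ε⁻¹≈ε)
  open import Algebra.Properties.AbelianGroup +-abelianGroup
    using (⁻¹-∙-comm)
  open import Algebra.Properties.Ring ring using (-1*x≈-x)
  open import Relation.Binary.Reasoning.PartialOrder poset

  fromℕ : ℕ → ℝ
  fromℕ n = n · 1#

  fromℤ : ℤ → ℝ
  fromℤ (+ n)    = fromℕ n
  fromℤ -[1+ n ] = - fromℕ (suc n)

  ∣_∣ : ℝ → ℝ
  ∣ x ∣ = x ⊔ (- x)

  IsNearestInteger : ℝ → ℤ → Set
  IsNearestInteger x m = ∀ k → ∣ x - fromℤ m ∣ ≤ ∣ x - fromℤ k ∣

  private

    +-monoʳ-≤ : ∀ z {x y} → x ≤ y → z + x ≤ z + y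
    +-monoʳ-≤ z {x} {y} x≤y = begin
      z + x  ≈⟨ +-comm z x ⟩
      x + z  ≤⟨ +-monoˡ-≤ z x≤y ⟩
      y + z  ≈⟨ +-comm y z ⟩
      z + y  ∎

    x+y-y : ∀ x y → (x + y) - y ≈ x
    x+y-y x y = trans (+-assoc x y (- y))
                  (trans (+-congˡ (-‿inverseʳ y)) (+-identityʳ x))

    x-y+y : ∀ x y → (x - y) + y ≈ x
    x-y+y x y = trans (+-assoc x (- y) y)
                  (trans (+-congˡ (-‿inverseˡ y)) (+-identityʳ x))

    neg-antimono : ∀ {x y} → x ≤ y → - y ≤ - x
    neg-antimono {x} {y} x≤y = begin
      - y              ≈⟨ x+y-y (- y) x ⟨
      (- y + x) - x    ≤⟨ +-monoˡ-≤ (- x) (+-monoʳ-≤ (- y) x≤y) ⟩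
      (- y + y) - x    ≈⟨ +-congʳ (-‿inverseˡ y) ⟩
      0# - x           ≈⟨ +-identityˡ (- x) ⟩
      - x              ∎

    0≤1 : 0# ≤ 1#
    0≤1 with total 0# 1#
    ... | inj₁ 0≤1 = 0≤1
    ... | inj₂ 1≤0 = begin
      0#            ≤⟨ *-nonneg 0≤-1 0≤-1 ⟩
      - 1# * - 1#   ≈⟨ -1*x≈-x (- 1#) ⟩
      - (- 1#)      ≈⟨ ⁻¹-involutive 1# ⟩
      1#            ∎
      where
      0≤-1 : 0# ≤ - 1#
      0≤-1 = ≤-respˡ-≈ ε⁻¹≈ε (neg-antimono 1≤0)

    1≰0 : ¬ 1# ≤ 0#
    1≰0 1≤0 = 1≉0 (antisym 1≤0 0≤1)

    fromℕ-nonneg : ∀ n → 0# ≤ fromℕ n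
    fromℕ-nonneg zero    = ≤-refl
    fromℕ-nonneg (suc n) = begin
      0#            ≤⟨ fromℕ-nonneg n ⟩
      fromℕ n       ≈⟨ +-identityˡ (fromℕ n) ⟨
      0# + fromℕ n  ≤⟨ +-monoˡ-≤ (fromℕ n) 0≤1 ⟩
      1# + fromℕ n  ∎

    fromℕ-mono : ∀ {m n} → m ℕ.≤ n → fromℕ m ≤ fromℕ n
    fromℕ-mono {n = n} ℕ.z≤n = fromℕ-nonneg n
    fromℕ-mono (ℕ.s≤s m≤n)   = +-monoʳ-≤ 1# (fromℕ-mono m≤n)

    fromℕ-suc≉0 : ∀ n → ¬ fromℕ (suc n) ≈ 0#
    fromℕ-suc≉0 n eq = 1≰0 (begin
      1#            ≈⟨ +-identityʳ 1# ⟨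
      1# + 0#       ≤⟨ +-monoʳ-≤ 1# (fromℕ-nonneg n) ⟩
      fromℕ (suc n) ≈⟨ eq ⟩
      0#            ∎)

    fromℤ-mono : ∀ {i j} → i ℤ.≤ j → fromℤ i ≤ fromℤ j
    fromℤ-mono (ℤ.-≤- n≤m)         = neg-antimono (fromℕ-mono (ℕ.s≤s n≤m))
    fromℤ-mono (ℤ.-≤+ {m} {n})     = begin
      - fromℕ (suc m)  ≤⟨ neg-antimono (fromℕ-nonneg (suc m)) ⟩
      - 0#             ≈⟨ ε⁻¹≈ε ⟩
      0#               ≤⟨ fromℕ-nonneg n ⟩
      fromℕ n          ∎
    fromℤ-mono (ℤ.+≤+ m≤n)         = fromℕ-mono m≤n

    fromℤ-suc : ∀ i → fromℤ (ℤ.suc i) ≈ 1# + fromℤ i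
    fromℤ-suc (+ n)        = refl
    fromℤ-suc -[1+ zero ]  = sym (trans (+-congˡ (-‿cong (+-identityʳ 1#)))
                                        (-‿inverseʳ 1#))
    fromℤ-suc -[1+ suc n ] = sym (begin-equality
      1# + - (1# + y)      ≈⟨ +-congˡ (⁻¹-∙-comm 1# y) ⟨
      1# + (- 1# - y)      ≈⟨ +-assoc 1# (- 1#) (- y) ⟨
      (1# - 1#) - y        ≈⟨ +-congʳ (-‿inverseʳ 1#) ⟩
      0# - y               ≈⟨ +-identityˡ (- y) ⟩
      - y                  ∎)
      where y = fromℕ (suc n)

    archimedean : ∀ x → ∃ λ n → x ≤ fromℕ n
    archimedean x with em {∃ λ n → x ≤ fromℕ n}
    ... | yes p = p
    ... | no ¬p = ⊥-elim (1≰0 (begin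
      1#              ≈⟨ x+y-y 1# s ⟨
      (1# + s) - s    ≤⟨ +-monoˡ-≤ (- s) (+-monoʳ-≤ 1# s≤s-1) ⟩
      (1# + (s - 1#)) - s ≈⟨ +-congʳ (trans (+-comm 1# _) (x-y+y s 1#)) ⟩
      s - s           ≈⟨ -‿inverseʳ s ⟩
      0#              ∎))
      where
      P : ℝ → Set
      P y = ∃ λ n → y ≈ fromℕ n

      x-bound : UpperBound P x
      x-bound y (n , y≈n) with total x (fromℕ n)
      ... | inj₁ x≤n = ⊥-elim (¬p (n , x≤n))
      ... | inj₂ n≤x = ≤-respˡ-≈ (sym y≈n) n≤x

      sup = supremum P (0# , 0 , refl) (x , x-bound)
      s   = proj₁ sup

      s≤s-1 : s ≤ s - 1#
      s≤s-1 = proj₂ (proj₂ sup) (s - 1#) λ y (n , y≈n) → begin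
        y                     ≈⟨ y≈n ⟩
        fromℕ n               ≈⟨ x+y-y (fromℕ n) 1# ⟨
        (fromℕ n + 1#) - 1#   ≈⟨ +-congʳ (+-comm (fromℕ n) 1#) ⟩
        fromℕ (suc n) - 1#    ≤⟨ +-monoˡ-≤ (- 1#)
                                   (proj₁ (proj₂ sup) _ (suc n , refl)) ⟩
        s - 1#                ∎

    Floor : ℝ → Set
    Floor x = ∃ λ m → fromℤ m ≤ x × x ≤ fromℤ (ℤ.suc m)

    search : ∀ x j i → fromℤ i ≤ x → x ≤ fromℕ j + fromℤ i → Floor x
    search x zero    i i≤x x≤i   =
      i , i≤x , ≤-trans (≤-respʳ-≈ (+-identityˡ _) x≤i)
                        (fromℤ-mono (ℤ.i≤suc[i] i))
    search x (suc j) i i≤x x≤j+i with total x (fromℤ (ℤ.suc i))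
    ... | inj₁ x≤i+1 = i , i≤x , x≤i+1
    ... | inj₂ i+1≤x = search x j (ℤ.suc i) i+1≤x (begin
      x                                 ≤⟨ x≤j+i ⟩
      (1# + fromℕ j) + fromℤ i          ≈⟨ +-congʳ (+-comm 1# (fromℕ j)) ⟩
      (fromℕ j + 1#) + fromℤ i          ≈⟨ +-assoc (fromℕ j) 1# (fromℤ i) ⟩
      fromℕ j + (1# + fromℤ i)          ≈⟨ +-congˡ (fromℤ-suc i) ⟨
      fromℕ j + fromℤ (ℤ.suc i)         ∎)

    floor : ∀ x → Floor x
    floor x with archimedean (- x)
    ... | n , -x≤n with archimedean (x - fromℤ -[1+ n ])
    ...   | j , x+n≤j = search x j -[1+ n ] -n≤x (begin
      x                                        ≈⟨ x-y+y x (fromℤ -[1+ n ]) ⟨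
      (x - fromℤ -[1+ n ]) + fromℤ -[1+ n ]    ≤⟨ +-monoˡ-≤ _ x+n≤j ⟩
      fromℕ j + fromℤ -[1+ n ]                 ∎)
      where
      -n≤x : - fromℕ (suc n) ≤ x
      -n≤x = begin
        - fromℕ (suc n)  ≤⟨ neg-antimono (fromℕ-mono (ℕ.n≤1+n n)) ⟩
        - fromℕ n        ≤⟨ neg-antimono -x≤n ⟩
        - (- x)          ≈⟨ ⁻¹-involutive x ⟩
        x                ∎

    ∣x-y∣-≥ : ∀ {x y} → y ≤ x → ∣ x - y ∣ ≈ x - y
    ∣x-y∣-≥ {x} {y} y≤x = x≤y⇒y⊔x≈y (begin
      - (x - y)   ≈⟨ ⁻¹-anti-homo-// x y ⟩
      y - x       ≤⟨ +-monoˡ-≤ (- x) y≤x ⟩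
      x - x       ≈⟨ -‿inverseʳ x ⟩
      0#          ≈⟨ -‿inverseʳ y ⟨
      y - y       ≤⟨ +-monoˡ-≤ (- y) y≤x ⟩
      x - y       ∎)

    ∣x-y∣-≤ : ∀ {x y} → x ≤ y → ∣ x - y ∣ ≈ y - x
    ∣x-y∣-≤ {x} {y} x≤y = trans (x≤y⇒x⊔y≈y (begin
      x - y       ≤⟨ +-monoˡ-≤ (- y) x≤y ⟩
      y - y       ≈⟨ -‿inverseʳ y ⟩
      0#          ≈⟨ -‿inverseʳ x ⟨
      x - x       ≤⟨ +-monoˡ-≤ (- x) x≤y ⟩
      y - x       ≈⟨ ⁻¹-anti-homo-// x y ⟨
      - (x - y)   ∎)) (⁻¹-anti-homo-// x y)

  nearestInteger : ∀ x → ∃ (IsNearestInteger x)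
  nearestInteger x with floor x
  ... | m , m≤x , x≤m+1 = pick (total ∣ x - fromℤ m ∣ ∣ x - fromℤ (ℤ.suc m) ∣)
    where
    below : ∀ {k} → k ℤ.≤ m → ∣ x - fromℤ m ∣ ≤ ∣ x - fromℤ k ∣
    below {k} k≤m = begin
      ∣ x - fromℤ m ∣  ≈⟨ ∣x-y∣-≥ m≤x ⟩
      x - fromℤ m      ≤⟨ +-monoʳ-≤ x (neg-antimono (fromℤ-mono k≤m)) ⟩
      x - fromℤ k      ≈⟨ ∣x-y∣-≥ (≤-trans (fromℤ-mono k≤m) m≤x) ⟨
      ∣ x - fromℤ k ∣  ∎

    above : ∀ {k} → ℤ.suc m ℤ.≤ k → ∣ x - fromℤ (ℤ.suc m) ∣ ≤ ∣ x - fromℤ k ∣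
    above {k} m<k = begin
      ∣ x - fromℤ (ℤ.suc m) ∣  ≈⟨ ∣x-y∣-≤ x≤m+1 ⟩
      fromℤ (ℤ.suc m) - x      ≤⟨ +-monoˡ-≤ (- x) (fromℤ-mono m<k) ⟩
      fromℤ k - x              ≈⟨ ∣x-y∣-≤ (≤-trans x≤m+1 (fromℤ-mono m<k)) ⟨
      ∣ x - fromℤ k ∣          ∎

    pick : ∣ x - fromℤ m ∣ ≤ ∣ x - fromℤ (ℤ.suc m) ∣ ⊎
           ∣ x - fromℤ (ℤ.suc m) ∣ ≤ ∣ x - fromℤ m ∣ →
           ∃ (IsNearestInteger x)
    pick (inj₁ m-nearer) = m , near
      where
      near : IsNearestInteger x m
      near k with k ℤ.≤? m
      ... | yes k≤m = below k≤m
      ... | no  k≰m = ≤-trans m-nearer (above (ℤ.i<j⇒suc[i]≤j (ℤ.≰⇒> k≰m)))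
    pick (inj₂ m+1-nearer) = ℤ.suc m , near
      where
      near : IsNearestInteger x (ℤ.suc m)
      near k with k ℤ.≤? m
      ... | yes k≤m = ≤-trans m+1-nearer (below k≤m)
      ... | no  k≰m = above (ℤ.i<j⇒suc[i]≤j (ℤ.≰⇒> k≰m))

  ‖_‖ : ℝ → ℝ
  ‖ x ‖ = ∣ x - fromℤ (proj₁ (nearestInteger x)) ∣

  1/_ : (n : ℕ) → .{{NonZero n}} → ℝ
  1/ suc n = proj₁ (inverse (fromℕ (suc n)) (fromℕ-suc≉0 n))

  -- The m + 1 runners have velocities 0, w₁, …, wₘ.
  sLRCForVelocities : ∀ {m} → (Fin m → ℝ) → Set
  sLRCForVelocities {m} w =
    ∀ (s : Fin m → ℝ) → ∃ λ t → ∀ i → 1/ suc m ≤ ‖ w i * t + s i ‖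

  -- The number of runners is one more than the number of velocities.
  sLRC : (n : ℕ) → .{{NonZero n}} → Set
  sLRC (suc m) = ∀ (w : Fin m → ℝ) → Injective _≡_ _≈_ w →
                 (∀ i → 0# < w i) → sLRCForVelocities w

ℚ² : Set
ℚ² = ℚ × ℚ

𝟎 : ℚ²
𝟎 = 0ℚ , 0ℚ

infixl 6 _⊕_ _⊖_
infixr 7 _•_

_⊕_ _⊖_ : ℚ² → ℚ² → ℚ²
(a , b) ⊕ (c , d) = a ℚ.+ c , b ℚ.+ d
(a , b) ⊖ (c , d) = a ℚ.- c , b ℚ.- d

⊝_ : ℚ² → ℚ²
⊝ (a , b) = ℚ.- a , ℚ.- b

_•_ : ℚ → ℚ² → ℚ²
r • (a , b) = r ℚ.* a , r ℚ.* b

-- Only ever applied to non-zero vectors, on which this relation is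
-- symmetric.
infix 4 _∥_

_∥_ : ℚ² → ℚ² → Set
u ∥ v = ∃ λ r → u ≡ r • v

-- The multiset S_P is the family (S p x) for x : Index k, so that "other
-- member of the multiset" means "member with a different index".
data Index (k : ℕ) : Set where
  single : Fin k → Index k
  plus   : (i j : Fin k) → .(i Fin.< j) → Index k
  minus  : (i j : Fin k) → .(i Fin.< j) → Index k

S : ∀ {k} → (Fin k → ℚ²) → Index k → ℚ²
S p (single i)    = p i
S p (plus  i j _) = p i ⊕ p j
S p (minus i j _) = p i ⊖ p j

SatisfiesLVP : ∀ {k} → (Fin k → ℚ²) → Set
SatisfiesLVP p = ∃ λ x → ∀ y → y ≢ x → ¬ S p x ∥ S p y

LVP : ℕ → Set
LVP k = ∀ (p : Fin k → ℚ²) →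
        (∀ i → p i ≢ 𝟎) →
        ¬ (∀ i j → p i ∥ p j) →
        (∀ i j → i ≢ j → p i ≢ p j × p i ≢ ⊝ p j) →
        SatisfiesLVP p

-- The empty gcd is 0, the unit of gcd.
gcdOver : ∀ {n} → (Fin n → ℕ) → Subset n → ℕ
gcdOver {n} v T = foldr gcd 0 (map v (filter (_∈? T) (allFin n)))

subsets : ∀ n → List (Subset n)
subsets zero    = Vec.[] ∷ []
subsets (suc n) = map (outside Vec.∷_) (subsets n) ++
                  map (inside  Vec.∷_) (subsets n)

-- The integer points z for which the line z + ℝv meets the cube [0,1]ⁿ, taken
-- modulo v, number at least ∑ v_S: a pair of S and j < v_S gives the point whose
-- line leaves the cube at time j / v_S, through the facets xᵢ = 1 with i ∈ S.  Put
-- N = C(n+1,2).  If there are more than N^(n-1) of them, two agree modulo N and v,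
-- and their difference gives w ∈ ℤⁿ, not parallel to v, with ‖w + τv‖∞ ≤ 1/N.
--
-- A lonely vector for the pᵢ = (vᵢ , wᵢ) is a projection ℤ² → ℤ that kills one pᵢ,
-- or identifies two of them up to sign, and keeps the others distinct up to sign
-- and non-zero.  sLRC for n runners then yields real t, r such that all
-- sᵢ + t vᵢ + r wᵢ are at distance ≥ 1/n from ℤ.  Rounding r to an integer while
-- moving along w + τv costs at most 1/(2N) = 1/n - 1/(n+1).

module Submission where

open import Defs
open import Algebra.Bundles using (CommutativeMonoid)
open import Axiom.ExcludedMiddle using (ExcludedMiddle)
open import Data.Fin.Base as Fin using (Fin; punchIn; punchOut; toℕ)
import Data.Fin.Properties as Fin
open import Data.Fin.Subset using (Subset; inside; outside; ⊤; _∈_; _∉_; _⊆_)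
open import Data.Fin.Subset.Properties using (_∈?_; ⊆-antisym)
open import Data.Integer.Base as ℤ using (ℤ; +_; -[1+_])
import Data.Integer.DivMod as ℤ
import Data.Integer.Divisibility.Signed as ℤ using (_∣_; divides; ∣ᵤ⇒∣)
import Data.Integer.Properties as ℤ
import Data.Integer.Solver as ℤ
open import Data.List.Base using ([]; _∷_; map; foldr; filter; allFin)
import Data.List.Membership.Propositional as List
open import Data.List.Membership.Propositional.Properties
  using (∈-filter⁺; ∈-allFin; ∈-map⁺; ∈-map⁻)
open import Data.List.Properties using (filter-none)
open import Data.List.Relation.Unary.All using (All; []; _∷_; universal)
import Data.List.Relation.Unary.All.Properties as All
open import Data.List.Relation.Unary.AllPairs using ([]; _∷_)
open import Data.List.Relation.Unary.Any using (here; there)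
open import Data.List.Relation.Unary.Unique.Propositional using (Unique)
import Data.List.Relation.Unary.Unique.Propositional.Properties as Unique
import Data.Maybe.Base as Maybe
open import Data.Nat.Base as ℕ using (ℕ; zero; suc; NonZero; z≤n; s≤s)
open import Data.Nat.Combinatorics using (_C_; nC1≡n; nCk+nC[k+1]≡[n+1]C[k+1])
import Data.Nat.Divisibility as ℕ using (_∣_; _∣0; ∣-trans; ∣⇒≤)
open import Data.Nat.Divisibility.Core using (divides)
open import Data.Nat.DivMod using (_/_; _%_; m≡m%n+[m/n]*n; m%n<n)
open import Data.Nat.GCD
  using (gcd; gcd[m,n]∣m; gcd[m,n]∣n; gcd-greatest; c*gcd[m,n]≡gcd[cm,cn])
open import Data.Nat.ListAction using (sum)
import Data.Nat.Properties as ℕ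
open import Data.Product.Base using (Σ; ∃; ∃₂; _×_; _,_; proj₁; proj₂; map₂)
open import Data.Rational.Base as ℚ using (ℚ)
import Data.Rational.Properties as ℚ
import Data.Rational.Unnormalised.Base as ℚᵘ
import Data.Rational.Unnormalised.Properties as ℚᵘ
open import Data.Sum.Base as Sum using (_⊎_; inj₁; inj₂)
import Data.Vec.Base as Vec
import Data.Vec.Properties as Vec
open import Function.Base using (_∘_)
open import Function.Definitions using (Injective)
open import Level using (0ℓ)
open import Relation.Binary.Definitions using (WeaklyDecidable; tri<; tri≈; tri>)
open import Relation.Binary.PropositionalEquality as ≡ using (_≡_; _≢_)
open import Relation.Nullary.Decidable.Core using (Dec; yes; no; dec⇒maybe; decidable-stable)
open import Relation.Nullary.Negation.Core using (¬_; contradiction; contradiction-irr)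

-- The condition on v makes solvable the equation for an initial time at which the
-- tied runner i is at 1/2, respectively meets runner j or its mirror image.
data Tie {n} (v q : Fin n → ℤ) (i : Fin n) : Set where
  still    : v i ≢ + 0 → q i ≡ + 0 → Tie v q i
  same     : ∀ j → j ≢ i → v i ℤ.- v j ≢ + 0 → q i ≡ q j → Tie v q i
  opposite : ∀ j → j ≢ i → v i ℤ.+ v j ≢ + 0 → q i ≡ ℤ.- q j → Tie v q i

-- When the parameters (t , r) move along `(α , β)`, the position sᵢ + t vᵢ + r wᵢ moves with
-- `speed i`. Setting `i₀` aside leaves n - 1 velocities, the number in sLRC for n runners. That
-- statement takes positive velocities, so it will be applied to the absolute values.
record LonelyDirection {n} (v w : Fin n → ℤ) : Set where
  field
    α β : ℤ

  speed : Fin n → ℤ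
  speed i = v i ℤ.* α ℤ.+ w i ℤ.* β

  field
    i₀             : Fin n
    tie            : Tie v speed i₀
    speed≢0        : ∀ i → i ≢ i₀ → speed i ≢ + 0
    speed-distinct : ∀ i j → i ≢ i₀ → j ≢ i₀ → i ≢ j → ℤ.∣ speed i ∣ ≢ ℤ.∣ speed j ∣

-- Distance to the integers

module RealFacts (em : ExcludedMiddle 0ℓ) (R : CompleteOrderedField) where

  open Real em R
  open import Algebra.Construct.NaturalChoice.Max totalOrder using (⊔-sel)
  open import Algebra.Properties.Monoid.Mult +-monoid using (×-homo-+)
  open import Algebra.Properties.Semiring.Mult semiring using (×1-homo-*)
  open import Algebra.Properties.Ring ring
    using (-‿distribˡ-*; -‿distribʳ-*; -0#≈0#; -‿involutive; -‿+-comm)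
  open import Algebra.Solver.Ring.AlmostCommutativeRing
    using (fromCommutativeRing; _-Raw-AlmostCommutative⟶_; Induced-equivalence)
  import Algebra.Solver.Ring as RingSolver
  open import Relation.Binary.Reasoning.Setoid setoid

  -- The integers inside the reals

  fromℤ-neg : ∀ i → fromℤ (ℤ.- i) ≈ - fromℤ i
  fromℤ-neg (+ zero)  = sym -0#≈0#
  fromℤ-neg (+ suc n) = refl
  fromℤ-neg -[1+ n ]  = sym (-‿involutive _)

  fromℤ-⊖ : ∀ m n → fromℤ (m ℤ.⊖ n) ≈ fromℕ m - fromℕ n
  fromℤ-⊖ m       zero    = sym (trans (+-congˡ -0#≈0#) (+-identityʳ _))
  fromℤ-⊖ zero    (suc n) = sym (+-identityˡ _)
  fromℤ-⊖ (suc m) (suc n) = begin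
    fromℤ (suc m ℤ.⊖ suc n)                ≡⟨ ≡.cong fromℤ (ℤ.[1+m]⊖[1+n]≡m⊖n m n) ⟩
    fromℤ (m ℤ.⊖ n)                        ≈⟨ fromℤ-⊖ m n ⟩
    fromℕ m - fromℕ n                      ≈⟨ +-identityˡ _ ⟨
    0# + (fromℕ m - fromℕ n)               ≈⟨ +-congʳ (-‿inverseʳ 1#) ⟨
    (1# - 1#) + (fromℕ m - fromℕ n)        ≈⟨ interchange 1# (- 1#) (fromℕ m) (- fromℕ n) ⟩
    fromℕ (suc m) + (- 1# - fromℕ n)       ≈⟨ +-congˡ (-‿+-comm 1# (fromℕ n)) ⟩
    fromℕ (suc m) - fromℕ (suc n)          ∎
    where
    open import Algebra.Properties.CommutativeSemigroup
      (CommutativeMonoid.commutativeSemigroup +-commutativeMonoid) using (interchange)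

  fromℤ-+ : ∀ i j → fromℤ (i ℤ.+ j) ≈ fromℤ i + fromℤ j
  fromℤ-+ (+ m)    (+ n)    = ×-homo-+ 1# m n
  fromℤ-+ (+ m)    -[1+ n ] = fromℤ-⊖ m (suc n)
  fromℤ-+ -[1+ m ] (+ n)    = trans (fromℤ-⊖ n (suc m)) (+-comm _ _)
  fromℤ-+ -[1+ m ] -[1+ n ] = begin
    - fromℕ (suc (suc (m ℕ.+ n)))       ≡⟨ ≡.cong (λ k → - fromℕ (suc k)) (ℕ.+-suc m n) ⟨
    - fromℕ (suc m ℕ.+ suc n)           ≈⟨ -‿cong (×-homo-+ 1# (suc m) (suc n)) ⟩
    - (fromℕ (suc m) + fromℕ (suc n))   ≈⟨ -‿+-comm _ _ ⟨
    - fromℕ (suc m) - fromℕ (suc n)     ∎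

  fromℤ-*⁺ : ∀ m j → fromℤ (+ m ℤ.* j) ≈ fromℕ m * fromℤ j
  fromℤ-*⁺ m (+ n)    = trans (reflexive (≡.cong fromℤ (≡.sym (ℤ.pos-* m n)))) (×1-homo-* m n)
  fromℤ-*⁺ m -[1+ n ] = begin
    fromℤ (+ m ℤ.* ℤ.- + suc n)     ≡⟨ ≡.cong fromℤ (ℤ.neg-distribʳ-* (+ m) (+ suc n)) ⟨
    fromℤ (ℤ.- (+ m ℤ.* + suc n))   ≈⟨ fromℤ-neg (+ m ℤ.* + suc n) ⟩
    - fromℤ (+ m ℤ.* + suc n)       ≈⟨ -‿cong (fromℤ-*⁺ m (+ suc n)) ⟩
    - (fromℕ m * fromℕ (suc n))     ≈⟨ -‿distribʳ-* _ _ ⟩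
    fromℕ m * - fromℕ (suc n)       ∎

  fromℤ-* : ∀ i j → fromℤ (i ℤ.* j) ≈ fromℤ i * fromℤ j
  fromℤ-* (+ m)    j = fromℤ-*⁺ m j
  fromℤ-* -[1+ m ] j = begin
    fromℤ (ℤ.- + suc m ℤ.* j)       ≡⟨ ≡.cong fromℤ (ℤ.neg-distribˡ-* (+ suc m) j) ⟨
    fromℤ (ℤ.- (+ suc m ℤ.* j))     ≈⟨ fromℤ-neg (+ suc m ℤ.* j) ⟩
    - fromℤ (+ suc m ℤ.* j)         ≈⟨ -‿cong (fromℤ-*⁺ (suc m) j) ⟩
    - (fromℕ (suc m) * fromℤ j)     ≈⟨ -‿distribˡ-* _ _ ⟩
    - fromℕ (suc m) * fromℤ j       ∎

  -- The ring solver reads the coefficient 1 as `fromℤ (+ 1)`, which unfolds to `1# + 0#` and not to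
  -- `1#`. Stating bounds with this form lets solver equations fit them without conversion.
  1ᴿ : ℝ
  1ᴿ = fromℤ (+ 1)

  1ᴿ≈1 : 1ᴿ ≈ 1#
  1ᴿ≈1 = +-identityʳ 1#

  fromℤ-morphism : ℤ.+-*-rawRing -Raw-AlmostCommutative⟶ fromCommutativeRing commutativeRing
  fromℤ-morphism = record
    { ⟦_⟧    = fromℤ
    ; +-homo = fromℤ-+
    ; *-homo = fromℤ-*
    ; -‿homo = fromℤ-neg
    ; 0-homo = refl
    ; 1-homo = 1ᴿ≈1
    }

  fromℤ-≟ : WeaklyDecidable (Induced-equivalence fromℤ-morphism)
  fromℤ-≟ i j = Maybe.map (λ i≡j → reflexive (≡.cong fromℤ i≡j)) (dec⇒maybe (i ℤ.≟ j))

  open RingSolver ℤ.+-*-rawRing (fromCommutativeRing commutativeRing) fromℤ-morphism fromℤ-≟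
    using (solve; con; _:+_; _:*_; _:-_; :-_; _:=_)


  -- Inequalities are proved by writing the difference of the two sides as an expression built from
  -- non-negative parts; what remains is an equation, mostly left to the ring solver.
  by : ∀ {x y z} → 0# ≤ z → z ≈ y - x → x ≤ y
  by {x} {y} {z} 0≤z z≈y-x =
    ≤-respˡ-≈ (+-identityˡ x) (≤-respʳ-≈ z+x≈y (+-monoˡ-≤ x 0≤z))
    where
    z+x≈y : z + x ≈ y
    z+x≈y = trans (+-congʳ z≈y-x) (solve 2 (λ x y → y :- x :+ x := y) refl x y)

  diff : ∀ {x y} → x ≤ y → 0# ≤ y - x
  diff {x} x≤y = ≤-respˡ-≈ (-‿inverseʳ x) (+-monoˡ-≤ (- x) x≤y)

  +-nonneg : ∀ {x y} → 0# ≤ x → 0# ≤ y → 0# ≤ x + y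
  +-nonneg {x} {y} 0≤x 0≤y =
    ≤-trans 0≤y (by 0≤x (solve 2 (λ x y → x := x :+ y :- y) refl x y))

  0≤1ᴿ : 0# ≤ 1ᴿ
  0≤1ᴿ with total 0# 1ᴿ
  ... | inj₁ 0≤1 = 0≤1
  ... | inj₂ 1≤0 = by (*-nonneg (diff 1≤0) (diff 1≤0))
    (solve 0 ((con (+ 0) :- con (+ 1)) :* (con (+ 0) :- con (+ 1)) := con (+ 1) :- con (+ 0)) refl)

  1≰0 : ¬ 1ᴿ ≤ 0#
  1≰0 1≤0 = 1≉0 (trans (sym 1ᴿ≈1) (antisym 1≤0 0≤1ᴿ))

  fromℕ-nonneg : ∀ n → 0# ≤ fromℕ n
  fromℕ-nonneg zero    = ≤-refl
  fromℕ-nonneg (suc n) = +-nonneg (≤-respʳ-≈ 1ᴿ≈1 0≤1ᴿ) (fromℕ-nonneg n)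

  fromℤ-mono : ∀ {i j} → i ℤ.≤ j → fromℤ i ≤ fromℤ j
  fromℤ-mono {i} {j} i≤j = by (nonneg (ℤ.i≤j⇒0≤j-i i≤j))
    (trans (fromℤ-+ j (ℤ.- i)) (+-congˡ (fromℤ-neg i)))
    where
    nonneg : ∀ {k} → ℤ.0ℤ ℤ.≤ k → 0# ≤ fromℤ k
    nonneg {+ k} _ = fromℕ-nonneg k

  <⇒fromℤ≉ : ∀ {i j} → i ℤ.< j → ¬ fromℤ i ≈ fromℤ j
  <⇒fromℤ≉ {i} {j} i<j eq = 1≰0 (by (diff (fromℤ-mono (ℤ.i<j⇒suc[i]≤j i<j))) (begin
    fromℤ j - fromℤ (ℤ.suc i)      ≈⟨ +-cong (sym eq) (-‿cong (fromℤ-+ (+ 1) i)) ⟩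
    fromℤ i - (1ᴿ + fromℤ i)
      ≈⟨ solve 1 (λ x → x :- (con (+ 1) :+ x) := con (+ 0) :- con (+ 1)) refl (fromℤ i) ⟩
    0# - 1ᴿ                        ∎))

  fromℤ-injective : ∀ {i j} → fromℤ i ≈ fromℤ j → i ≡ j
  fromℤ-injective {i} {j} eq with ℤ.<-cmp i j
  ... | tri< i<j _ _ = contradiction eq (<⇒fromℤ≉ i<j)
  ... | tri≈ _ i≡j _ = i≡j
  ... | tri> _ _ j<i = contradiction (sym eq) (<⇒fromℤ≉ j<i)

  fromℕ-injective : ∀ m n → fromℕ m ≈ fromℕ n → m ≡ n
  fromℕ-injective m n eq = ℤ.+-injective (fromℤ-injective {+ m} {+ n} eq)

  inverse-nonneg : ∀ {x y} → 0# ≤ x → x * y ≈ 1ᴿ → 0# ≤ y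
  inverse-nonneg {x} {y} 0≤x xy≈1 with total 0# y
  ... | inj₁ 0≤y = 0≤y
  ... | inj₂ y≤0 = contradiction (by (*-nonneg 0≤x (diff y≤0)) (begin
    x * (0# - y)   ≈⟨ solve 2 (λ x y → x :* (con (+ 0) :- y) := con (+ 0) :- x :* y) refl x y ⟩
    0# - x * y     ≈⟨ +-congˡ (-‿cong xy≈1) ⟩
    0# - 1ᴿ        ∎)) 1≰0

  reciprocal : ∀ i → i ≢ + 0 → ∃ λ y → fromℤ i * y ≈ 1ᴿ
  reciprocal i i≢0 with y , eq ← inverse (fromℤ i) (λ eq → i≢0 (fromℤ-injective eq)) =
    y , trans eq (sym 1ᴿ≈1)

  1/-inverse : ∀ n → fromℕ (suc n) * 1/ suc n ≈ 1ᴿ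
  1/-inverse n = trans (proj₂ (inverse (fromℕ (suc n)) _)) (sym 1ᴿ≈1)

  1/-nonneg : ∀ n → 0# ≤ 1/ suc n
  1/-nonneg n = inverse-nonneg (fromℕ-nonneg (suc n)) (1/-inverse n)

  ≤∣∣⇒ : ∀ {c} x → c ≤ ∣ x ∣ → c ≤ x ⊎ c ≤ - x
  ≤∣∣⇒ x c≤∣x∣ = Sum.map (λ eq → ≤-respʳ-≈ eq c≤∣x∣) (λ eq → ≤-respʳ-≈ eq c≤∣x∣) (⊔-sel x (- x))

  -- Equivalent to c ≤ ‖ x ‖, without reference to the nearest integer.
  Far : ℝ → ℝ → Set
  Far c x = ∀ k → c ≤ x - fromℤ k ⊎ c ≤ fromℤ k - x

  ≤‖‖⇒Far : ∀ {c} x → c ≤ ‖ x ‖ → Far c x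
  ≤‖‖⇒Far {c} x c≤‖x‖ k =
    Sum.map₂ (≤-respʳ-≈ (solve 2 (λ x k → :- (x :- k) := k :- x) refl x (fromℤ k)))
      (≤∣∣⇒ (x - fromℤ k) (≤-trans c≤‖x‖ (proj₂ (nearestInteger x) k)))

  Far⇒≤∣-∣ : ∀ {c} x → Far c x → ∀ m → c ≤ ∣ x - fromℤ m ∣
  Far⇒≤∣-∣ x far m with far m
  ... | inj₁ c≤x-m = ≤-trans c≤x-m (x≤x⊔y _ _)
  ... | inj₂ c≤m-x = ≤-trans c≤m-x (≤-trans
    (≤-reflexive (solve 2 (λ x m → m :- x := :- (x :- m)) refl x (fromℤ m))) (x≤y⊔x _ _))

  Far⇒≤‖‖ : ∀ {c} x → Far c x → c ≤ ‖ x ‖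
  Far⇒≤‖‖ x far = Far⇒≤∣-∣ x far (proj₁ (nearestInteger x))

  Far-resp-≈ : ∀ {c x y} → x ≈ y → Far c x → Far c y
  Far-resp-≈ x≈y far k =
    Sum.map (≤-respʳ-≈ (+-congʳ x≈y)) (≤-respʳ-≈ (+-congˡ (-‿cong x≈y))) (far k)

  Far-neg : ∀ {c x} → Far c x → Far c (- x)
  Far-neg {c} {x} far k with far (ℤ.- k)
  ... | inj₁ le = inj₂ (≤-respʳ-≈ (trans (+-congˡ (-‿cong (fromℤ-neg k)))
    (solve 2 (λ x k → x :- (:- k) := k :- (:- x)) refl x (fromℤ k))) le)
  ... | inj₂ le = inj₁ (≤-respʳ-≈ (trans (+-congʳ (fromℤ-neg k))
    (solve 2 (λ x k → :- k :- x := :- x :- k) refl x (fromℤ k))) le)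

  Far-shift : ∀ {c x} j → Far c x → Far c (x - fromℤ j)
  Far-shift {c} {x} j far k =
    Sum.map (≤-respʳ-≈ (trans (+-congˡ (-‿cong (fromℤ-+ j k)))
               (solve 3 (λ x j k → x :- (j :+ k) := x :- j :- k) refl x (fromℤ j) (fromℤ k))))
            (≤-respʳ-≈ (trans (+-congʳ (fromℤ-+ j k))
               (solve 3 (λ x j k → j :+ k :- x := k :- (x :- j)) refl x (fromℤ j) (fromℤ k))))
            (far (j ℤ.+ k))

  -- Distance to ℤ is 1-Lipschitz; the two hypotheses together say ∣ε∣ ≤ a - b.
  Far-perturb : ∀ {a b x ε} → ε ≤ a - b → - ε ≤ a - b → Far a x → Far b (x - ε)
  Far-perturb {a} {b} {x} {ε} ε≤ -ε≤ far k =
    Sum.map (λ le → by (+-nonneg (diff le) (diff ε≤))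
               (solve 5 (λ a b x e k → (x :- k :- a) :+ (a :- b :- e) := x :- e :- k :- b)
                  refl a b x ε (fromℤ k)))
            (λ le → by (+-nonneg (diff le) (diff -ε≤))
               (solve 5 (λ a b x e k → (k :- x :- a) :+ (a :- b :- (:- e)) := k :- (x :- e) :- b)
                  refl a b x ε (fromℤ k)))
            (far k)

  AbsAtMost1 : ℝ → Set
  AbsAtMost1 x = x ≤ 1ᴿ × - x ≤ 1ᴿ

  -- For x ≥ 0, 1 - xy = (1 - x) + x (1 - y) is a sum of non-negative terms. For x ≤ 0 the same
  -- identity is applied to -x and -y.
  *-AbsAtMost1 : ∀ {x y c} → AbsAtMost1 x → AbsAtMost1 y → 0# ≤ c → x * y * c ≤ c
  *-AbsAtMost1 {x} {y} {c} (x≤1 , -x≤1) (y≤1 , -y≤1) 0≤c with total 0# x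
  ... | inj₁ 0≤x = by (*-nonneg (+-nonneg (diff x≤1) (*-nonneg 0≤x (diff y≤1))) 0≤c)
    (solve 3 (λ x y c → ((con (+ 1) :- x) :+ x :* (con (+ 1) :- y)) :* c := c :- x :* y :* c)
      refl x y c)
  ... | inj₂ x≤0 = by (*-nonneg (+-nonneg (diff -x≤1) (*-nonneg (diff x≤0) (diff -y≤1))) 0≤c)
    (solve 3 (λ x y c → ((con (+ 1) :- (:- x)) :+ (con (+ 0) :- x) :* (con (+ 1) :- (:- y))) :* c
                        := c :- x :* y :* c) refl x y c)

  -- It suffices to compare m with its two neighbours. From r - m ≤ ∣r - (m + 1)∣ follows r - m ≤ 1
  -- - (r - m), the other sign being absurd; m - 1 gives the lower bound. The factor 2 avoids
  -- fractions.
  nearest-half : ∀ r → ∃ λ m → AbsAtMost1 (fromℤ (+ 2) * (r - fromℤ m))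
  nearest-half r with m , near ← nearestInteger r = m , above , below
    where
    M = fromℤ m
    M+1 = fromℤ-+ (+ 1) m
    M-1 = fromℤ-+ -[1+ 0 ] m
    above : fromℤ (+ 2) * (r - M) ≤ 1ᴿ
    above with ≤∣∣⇒ (r - fromℤ (+ 1 ℤ.+ m)) (≤-trans (x≤x⊔y _ _) (near (+ 1 ℤ.+ m)))
    ... | inj₁ le = contradiction (by (diff le) (trans (+-congʳ (+-congˡ (-‿cong M+1)))
        (solve 2 (λ r M → r :- (con (+ 1) :+ M) :- (r :- M) := con (+ 0) :- con (+ 1)) refl r M)))
        1≰0
    ... | inj₂ le = by (diff le) (trans (+-congʳ (-‿cong (+-congˡ (-‿cong M+1))))
        (solve 2 (λ r M → :- (r :- (con (+ 1) :+ M)) :- (r :- M)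
                          := con (+ 1) :- con (+ 2) :* (r :- M)) refl r M))
    below : - (fromℤ (+ 2) * (r - M)) ≤ 1ᴿ
    below with ≤∣∣⇒ (r - fromℤ (-[1+ 0 ] ℤ.+ m)) (≤-trans (x≤y⊔x _ _) (near (-[1+ 0 ] ℤ.+ m)))
    ... | inj₁ le = by (diff le) (trans (+-congʳ (+-congˡ (-‿cong M-1)))
        (solve 2 (λ r M → r :- (con -[1+ 0 ] :+ M) :- (:- (r :- M))
                          := con (+ 1) :- (:- (con (+ 2) :* (r :- M)))) refl r M))
    ... | inj₂ le = contradiction (by (diff le) (trans (+-congʳ (-‿cong (+-congˡ (-‿cong M-1))))
        (solve 2 (λ r M → :- (r :- (con -[1+ 0 ] :+ M)) :- (:- (r :- M))
                          := con (+ 0) :- con (+ 1)) refl r M)))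
        1≰0

  -- From one time parameter to two

  flip : ℤ → ℝ → ℝ
  flip (+ _)    x = x
  flip -[1+ _ ] x = - x

  -- A runner of negative speed is replaced by its mirror image, which has positive speed and the
  -- same distance to ℤ. This is how sLRC, stated for positive velocities, applies to signed ones.
  Far-unflip : ∀ {c x u} q → Far c (fromℕ ℤ.∣ q ∣ * u + flip q x) → Far c (x + fromℤ q * u)
  Far-unflip {c} {x} {u} (+ n)    = Far-resp-≈ (+-comm _ _)
  Far-unflip {c} {x} {u} -[1+ n ] = Far-resp-≈
    (solve 3 (λ q u x → :- (q :* u :+ (:- x)) := x :+ (:- q) :* u) refl (fromℕ (suc n)) u x)
    ∘ Far-neg

  solve-linear : ∀ i b → i ≢ + 0 → ∃ λ t → fromℤ i * t ≈ b
  solve-linear i b i≢0 with y , iy≈1 ← reciprocal i i≢0 = y * b , (begin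
    fromℤ i * (y * b)   ≈⟨ *-assoc _ _ _ ⟨
    fromℤ i * y * b     ≈⟨ *-congʳ (trans iy≈1 1ᴿ≈1) ⟩
    1# * b              ≈⟨ *-identityˡ b ⟩
    b                   ∎)

  -- Every integer is ≤ 0 or ≥ 1, so 1/2 has distance at least 1/2 from each; `1 ≤ m` gives 1/(m +
  -- 1) ≤ 1/2.
  Far-half : ∀ m {h} → 1 ℕ.≤ m → fromℤ (+ 2) * h ≈ 1ᴿ → Far (1/ suc m) h
  Far-half m {h} 1≤m 2h≈1 k = Sum.map (≤-trans a≤h) (≤-trans a≤h) h-far
    where
    a = 1/ suc m
    0≤h : 0# ≤ h
    0≤h = inverse-nonneg (fromℕ-nonneg 2) 2h≈1
    a≤h : a ≤ h
    a≤h = by (*-nonneg (*-nonneg 0≤h (diff (fromℤ-mono (ℤ.+≤+ (ℕ.s≤s 1≤m))))) (1/-nonneg m)) (begin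
      h * (fromℕ (suc m) - fromℤ (+ 2)) * a
        ≈⟨ solve 3 (λ h n a → h :* (n :- con (+ 2)) :* a := n :* a :* h :- con (+ 2) :* h :* a)
             refl h (fromℕ (suc m)) a ⟩
      fromℕ (suc m) * a * h - fromℤ (+ 2) * h * a
        ≈⟨ +-cong (*-congʳ (1/-inverse m)) (-‿cong (*-congʳ 2h≈1)) ⟩
      1ᴿ * h - 1ᴿ * a
        ≈⟨ solve 2 (λ h a → con (+ 1) :* h :- con (+ 1) :* a := h :- a) refl h a ⟩
      h - a                                              ∎)
    h-far : h ≤ h - fromℤ k ⊎ h ≤ fromℤ k - h
    h-far with k ℤ.≤? + 0
    ... | yes k≤0 = inj₁ (by (diff (fromℤ-mono k≤0))
      (solve 2 (λ h k → con (+ 0) :- k := h :- k :- h) refl h (fromℤ k)))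
    ... | no  k≰0 = inj₂ (by (diff (fromℤ-mono (ℤ.i<j⇒suc[i]≤j (ℤ.≰⇒> k≰0)))) (begin
      fromℤ k - 1ᴿ                ≈⟨ +-congˡ (-‿cong 2h≈1) ⟨
      fromℤ k - fromℤ (+ 2) * h
        ≈⟨ solve 2 (λ h k → k :- con (+ 2) :* h := k :- h :- h) refl h (fromℤ k) ⟩
      fromℤ k - h - h             ∎))

  -- The time t₀ is chosen before u. Because the speeds `q` are tied, the coincidence arranged at u
  -- = 0 persists for all u: runner `i₀` stays at 1/2, or travels with runner j, or with the mirror
  -- image of j, and so inherits its distance to ℤ.
  meet-tied : ∀ {m} → 1 ℕ.≤ m → (v q : Fin (suc m) → ℤ) (s : Fin (suc m) → ℝ) → ∀ i₀ → Tie v q i₀ →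
    ∃ λ t₀ → ∀ u → (∀ i → i ≢ i₀ → Far (1/ suc m) (s i + fromℤ (v i) * t₀ + fromℤ (q i) * u)) →
                   Far (1/ suc m) (s i₀ + fromℤ (v i₀) * t₀ + fromℤ (q i₀) * u)
  meet-tied {m} 1≤m v q s i₀ (still v≢0 q≡0)
    = map₂ (λ {t} eq u _ → Far-resp-≈ (begin
      h
        ≈⟨ solve 3 (λ s h u → h := s :+ (h :- s) :+ con (+ 0) :* u) refl (s i₀) h u ⟩
      s i₀ + (h - s i₀) + 0# * u
        ≈⟨ +-cong (+-congˡ eq) (*-congʳ (reflexive (≡.cong fromℤ q≡0))) ⟨
      s i₀ + fromℤ (v i₀) * t + fromℤ (q i₀) * u  ∎) (Far-half m 1≤m (proj₂ ½)))
      (solve-linear (v i₀) (h - s i₀) v≢0)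
    where
    ½ = reciprocal (+ 2) (λ ())
    h = proj₁ ½
  meet-tied {m} 1≤m v q s i₀ (same j j≢i₀ v≢v q≡q)
    = map₂ (λ {t} eq u far → Far-resp-≈ (begin
      s j + fromℤ (v j) * t + fromℤ (q j) * u
        ≈⟨ solve 6 (λ si sj vi vj t qu →
             sj :+ vj :* t :+ qu := si :+ vi :* t :+ qu :+ ((sj :- si) :- (vi :- vj) :* t))
             refl (s i₀) (s j) (fromℤ (v i₀)) (fromℤ (v j)) t (fromℤ (q j) * u) ⟩
      s i₀ + fromℤ (v i₀) * t + fromℤ (q j) * u + ((s j - s i₀) - (fromℤ (v i₀) - fromℤ (v j)) * t)
        ≈⟨ +-congˡ (+-congˡ (-‿cong (trans (*-congʳ (sym
             (trans (fromℤ-+ (v i₀) (ℤ.- v j)) (+-congˡ (fromℤ-neg (v j)))))) eq))) ⟩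
      s i₀ + fromℤ (v i₀) * t + fromℤ (q j) * u + ((s j - s i₀) - (s j - s i₀))
        ≈⟨ trans (+-congˡ (-‿inverseʳ _)) (+-identityʳ _) ⟩
      s i₀ + fromℤ (v i₀) * t + fromℤ (q j) * u
        ≡⟨ ≡.cong (λ p → s i₀ + fromℤ (v i₀) * t + fromℤ p * u) q≡q ⟨
      s i₀ + fromℤ (v i₀) * t + fromℤ (q i₀) * u  ∎) (far j j≢i₀))
      (solve-linear (v i₀ ℤ.- v j) (s j - s i₀) v≢v)
  meet-tied {m} 1≤m v q s i₀ (opposite j j≢i₀ v≢-v q≡-q)
    = map₂ (λ {t} eq u far → Far-resp-≈ (begin
      - (s j + fromℤ (v j) * t + fromℤ (q j) * u)
        ≈⟨ solve 7 (λ si sj vi vj t q u →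
             :- (sj :+ vj :* t :+ q :* u)
             := si :+ vi :* t :+ (:- q) :* u :+ (:- (sj :+ si) :- (vi :+ vj) :* t))
             refl (s i₀) (s j) (fromℤ (v i₀)) (fromℤ (v j)) t (fromℤ (q j)) u ⟩
      s i₀ + fromℤ (v i₀) * t + (- fromℤ (q j)) * u
        + (- (s j + s i₀) - (fromℤ (v i₀) + fromℤ (v j)) * t)
        ≈⟨ +-congˡ (+-congˡ (-‿cong (trans (*-congʳ (sym (fromℤ-+ (v i₀) (v j)))) eq))) ⟩
      s i₀ + fromℤ (v i₀) * t + (- fromℤ (q j)) * u + (- (s j + s i₀) - (- (s j + s i₀)))
        ≈⟨ trans (+-congˡ (-‿inverseʳ _)) (+-identityʳ _) ⟩
      s i₀ + fromℤ (v i₀) * t + (- fromℤ (q j)) * u  ≈⟨ +-congˡ (*-congʳ (fromℤ-neg (q j))) ⟨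
      s i₀ + fromℤ (v i₀) * t + fromℤ (ℤ.- q j) * u
        ≡⟨ ≡.cong (λ p → s i₀ + fromℤ (v i₀) * t + fromℤ p * u) q≡-q ⟨
      s i₀ + fromℤ (v i₀) * t + fromℤ (q i₀) * u  ∎) (Far-neg (far j j≢i₀)))
      (solve-linear (v i₀ ℤ.+ v j) (- (s j + s i₀)) v≢-v)

  -- The pair (t , r) is sought on the line (t₀ + α u , β u). There the runners have the velocities
  -- `speed i`; sLRC finds a u for all but `i₀`, and the choice of t₀ takes care of `i₀`.
  two-dimensional : ∀ m → 1 ℕ.≤ m → sLRC (suc m) → (v w : Fin (suc m) → ℤ) →
                    LonelyDirection v w → (s : Fin (suc m) → ℝ) →
                    ∃₂ λ t r → ∀ i → Far (1/ suc m) (s i + fromℤ (v i) * t + fromℤ (w i) * r)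
  two-dimensional m 1≤m slrc v w dir s =
    t₀ + fromℤ α * u , fromℤ β * u , λ i → Far-resp-≈ (position i) (far i (i Fin.≟ i₀))
    where
    open LonelyDirection dir

    tied = meet-tied 1≤m v speed s i₀ tie
    t₀ = proj₁ tied

    others : Fin m → ℤ
    others = speed ∘ punchIn i₀

    distinct : ∀ k l → fromℕ ℤ.∣ others k ∣ ≈ fromℕ ℤ.∣ others l ∣ → k ≡ l
    distinct k l eq = decidable-stable (k Fin.≟ l) λ k≢l →
      speed-distinct _ _ (Fin.punchInᵢ≢i i₀ k) (Fin.punchInᵢ≢i i₀ l)
        (k≢l ∘ Fin.punchIn-injective i₀ k l)
        (fromℕ-injective ℤ.∣ others k ∣ ℤ.∣ others l ∣ eq)

    positive : ∀ k → 0# < fromℕ ℤ.∣ others k ∣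
    positive k = fromℕ-nonneg ℤ.∣ others k ∣ , λ 0≈q → speed≢0 _ (Fin.punchInᵢ≢i i₀ k)
      (ℤ.∣i∣≡0⇒i≡0 (≡.sym (fromℕ-injective 0 ℤ.∣ others k ∣ 0≈q)))

    s′ : Fin (suc m) → ℝ
    s′ i = s i + fromℤ (v i) * t₀

    meeting = slrc (λ k → fromℕ ℤ.∣ others k ∣) (λ {k} {l} → distinct k l) positive
                   (λ k → flip (others k) (s′ (punchIn i₀ k)))
    u = proj₁ meeting

    far-others : ∀ i → i ≢ i₀ → Far (1/ suc m) (s′ i + fromℤ (speed i) * u)
    far-others i i≢i₀ = ≡.subst (λ i → Far (1/ suc m) (s′ i + fromℤ (speed i) * u))
      (Fin.punchIn-punchOut (i≢i₀ ∘ ≡.sym))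
      (Far-unflip (others k) (≤‖‖⇒Far _ (proj₂ meeting k)))
      where k = punchOut (i≢i₀ ∘ ≡.sym)

    far : ∀ i → Dec (i ≡ i₀) → Far (1/ suc m) (s′ i + fromℤ (speed i) * u)
    far i (yes i≡i₀) = ≡.subst (λ i → Far (1/ suc m) (s′ i + fromℤ (speed i) * u))
      (≡.sym i≡i₀) (proj₂ tied u far-others)
    far i (no  i≢i₀) = far-others i i≢i₀

    position : ∀ i → s′ i + fromℤ (speed i) * u ≈
                     s i + fromℤ (v i) * (t₀ + fromℤ α * u) + fromℤ (w i) * (fromℤ β * u)
    position i = trans
      (+-congˡ (*-congʳ (trans (fromℤ-+ (v i ℤ.* α) (w i ℤ.* β))
        (+-cong (fromℤ-* (v i) α) (fromℤ-* (w i) β)))))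
      (solve 7 (λ s v t α w β u → s :+ v :* t :+ (v :* α :+ w :* β) :* u
                                  := s :+ v :* (t :+ α :* u) :+ w :* (β :* u))
        refl (s i) (fromℤ (v i)) t₀ (fromℤ α) (fromℤ (w i)) (fromℤ β) u)

  -- Rounding the second parameter to an integer

  private
    module Gap (m N : ℕ) (2N≡ : 2 ℕ.* N ≡ suc m ℕ.* suc (suc m)) where
      n a b : ℝ
      n = fromℕ (suc m)
      a = 1/ suc m
      b = 1/ suc (suc m)

      [1+n]b≈1 : (1ᴿ + n) * b ≈ 1ᴿ
      [1+n]b≈1 = trans (*-congʳ (+-congʳ 1ᴿ≈1)) (1/-inverse (suc m))

      a-b≈ab : a - b ≈ a * b
      a-b≈ab = begin
        a - b
          ≈⟨ solve 2 (λ a b → a :- b := a :* con (+ 1) :- b :* con (+ 1)) refl a b ⟩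
        a * 1ᴿ - b * 1ᴿ
          ≈⟨ +-cong (*-congˡ [1+n]b≈1) (-‿cong (*-congˡ (1/-inverse m))) ⟨
        a * ((1ᴿ + n) * b) - b * (n * a)
          ≈⟨ solve 3 (λ a b n → a :* ((con (+ 1) :+ n) :* b) :- b :* (n :* a) := a :* b)
               refl a b n ⟩
        a * b                                ∎

      2Nab≈1 : fromℤ (+ 2) * fromℕ N * (a * b) ≈ 1ᴿ
      2Nab≈1 = begin
        fromℤ (+ 2) * fromℕ N * (a * b)        ≈⟨ *-congʳ (fromℤ-* (+ 2) (+ N)) ⟨
        fromℤ (+ 2 ℤ.* + N) * (a * b)
          ≡⟨ ≡.cong (λ k → fromℤ k * (a * b)) (≡.trans (≡.sym (ℤ.pos-* 2 N))
               (≡.trans (≡.cong +_ 2N≡) (ℤ.pos-* (suc m) (suc (suc m))))) ⟩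
        fromℤ (+ suc m ℤ.* + suc (suc m)) * (a * b)
          ≈⟨ *-congʳ (trans (fromℤ-* (+ suc m) (+ suc (suc m))) (*-congˡ (+-congʳ (sym 1ᴿ≈1)))) ⟩
        n * (1ᴿ + n) * (a * b)
          ≈⟨ solve 3 (λ a b n → n :* (con (+ 1) :+ n) :* (a :* b) := n :* a :* ((con (+ 1) :+ n) :* b))
               refl a b n ⟩
        n * a * ((1ᴿ + n) * b)                 ≈⟨ *-cong (1/-inverse m) [1+n]b≈1 ⟩
        1ᴿ * 1ᴿ
          ≈⟨ solve 0 (con (+ 1) :* con (+ 1) := con (+ 1)) refl ⟩
        1ᴿ                                     ∎

  -- Put τ = c / (N D) and δ = r - ρ. In wᵢ r = ρ wᵢ + δ (wᵢ + τ vᵢ) - δ τ vᵢ the first term is an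
  -- integer, the second has absolute value at most (1/2)(1/N), and the third is absorbed by a
  -- change of time.
  round-time : ∀ m N D → 2 ℕ.* N ≡ suc m ℕ.* suc (suc m) → D ≢ 0 →
    ∀ {k} (v w : Fin k → ℤ) (c : ℤ) (s : Fin k → ℝ) →
    (∀ i → + N ℤ.* + D ℤ.* w i ℤ.+ c ℤ.* v i ℤ.≤ + D) →
    (∀ i → ℤ.- + D ℤ.≤ + N ℤ.* + D ℤ.* w i ℤ.+ c ℤ.* v i) →
    ∀ t r ρ → AbsAtMost1 (fromℤ (+ 2) * (r - fromℤ ρ)) →
    (∀ i → Far (1/ suc m) (s i + fromℤ (v i) * t + fromℤ (w i) * r)) →
    ∃ λ t′ → ∀ i → Far (1/ suc (suc m)) (fromℤ (v i) * t′ + s i)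
  round-time m N D 2N≡ D≢0 v w c s E≤D -D≤E t r ρ δ-bound far =
    t′ , λ i → Far-resp-≈ (position i) (Far-perturb (ε≤ i) (-ε≤ i) (Far-shift (ρ ℤ.* w i) (far i)))
    where
    open Gap m N 2N≡
    δ = r - fromℤ ρ
    reciprocal-D = reciprocal (+ D) (D≢0 ∘ ℤ.+-injective)
    d = proj₁ reciprocal-D

    0≤d : 0# ≤ d
    0≤d = inverse-nonneg (fromℕ-nonneg D) (proj₂ reciprocal-D)

    0≤ab : 0# ≤ a * b
    0≤ab = *-nonneg (1/-nonneg m) (1/-nonneg (suc m))

    -- Since 2ab = 1/N and d = 1/D, this is t - δ τ.
    t′ = t - fromℤ (+ 2) * δ * fromℤ c * d * (a * b)

    E : ∀ i → ℤ
    E i = + N ℤ.* + D ℤ.* w i ℤ.+ c ℤ.* v i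

    -- Here η is N (wᵢ + τ vᵢ), bounded by 1, and ε is the error δ (wᵢ + τ vᵢ), bounded by ab = a -
    -- b.
    η ε : ∀ i → ℝ
    η i = fromℤ (E i) * d
    ε i = fromℤ (+ 2) * δ * η i * (a * b)

    η-bound : ∀ i → AbsAtMost1 (η i)
    η-bound i =
      by (*-nonneg (diff (fromℤ-mono (E≤D i))) 0≤d) (begin
        (fromℕ D - fromℤ (E i)) * d
          ≈⟨ solve 3 (λ D E d → (D :- E) :* d := D :* d :- E :* d) refl (fromℕ D) (fromℤ (E i)) d ⟩
        fromℕ D * d - fromℤ (E i) * d     ≈⟨ +-congʳ (proj₂ reciprocal-D) ⟩
        1ᴿ - η i                          ∎) ,
      by (*-nonneg (diff (fromℤ-mono (-D≤E i))) 0≤d) (begin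
        (fromℤ (E i) - fromℤ (ℤ.- + D)) * d       ≈⟨ *-congʳ (+-congˡ (-‿cong (fromℤ-neg (+ D)))) ⟩
        (fromℤ (E i) - - fromℕ D) * d
          ≈⟨ solve 3 (λ D E d → (E :- (:- D)) :* d := D :* d :- (:- (E :* d)))
               refl (fromℕ D) (fromℤ (E i)) d ⟩
        fromℕ D * d - - (fromℤ (E i) * d)     ≈⟨ +-congʳ (proj₂ reciprocal-D) ⟩
        1ᴿ - - η i                          ∎)

    ε≤ : ∀ i → ε i ≤ a - b
    ε≤ i = ≤-respʳ-≈ (sym a-b≈ab) (*-AbsAtMost1 δ-bound (η-bound i) 0≤ab)

    -2δ-bound : AbsAtMost1 (- (fromℤ (+ 2) * δ))
    -2δ-bound = proj₂ δ-bound , ≤-respˡ-≈ (sym (-‿involutive _)) (proj₁ δ-bound)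

    -ε≤ : ∀ i → - ε i ≤ a - b
    -ε≤ i = ≤-respˡ-≈
      (solve 3 (λ x η p → (:- x) :* η :* p := :- (x :* η :* p)) refl (fromℤ (+ 2) * δ) (η i) (a * b))
      (≤-respʳ-≈ (sym a-b≈ab) (*-AbsAtMost1 -2δ-bound (η-bound i) 0≤ab))

    position : ∀ i → s i + fromℤ (v i) * t + fromℤ (w i) * r - fromℤ (ρ ℤ.* w i) - ε i
                     ≈ fromℤ (v i) * t′ + s i
    position i = begin
      s i + V * t + W * r - fromℤ (ρ ℤ.* w i) - ε i
        ≈⟨ +-cong (+-congˡ (-‿cong (fromℤ-* ρ (w i)))) (-‿cong (*-congʳ (*-congˡ (*-congʳ E≈)))) ⟩
      s i + V * t + W * r - fromℤ ρ * W
        - fromℤ (+ 2) * δ * ((fromℕ N * fromℕ D * W + fromℤ c * V) * d) * (a * b)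
        ≈⟨ solve 11 (λ s v t w r ρ N D c d p →
             s :+ v :* t :+ w :* r :- ρ :* w
                :- con (+ 2) :* (r :- ρ) :* ((N :* D :* w :+ c :* v) :* d) :* p
             := v :* (t :- con (+ 2) :* (r :- ρ) :* c :* d :* p) :+ s
                :+ w :* (r :- ρ) :* (con (+ 1) :- con (+ 2) :* N :* p :* (D :* d)))
             refl (s i) V t W r (fromℤ ρ) (fromℕ N) (fromℕ D) (fromℤ c) d (a * b) ⟩
      V * t′ + s i + W * δ * (1ᴿ - fromℤ (+ 2) * fromℕ N * (a * b) * (fromℕ D * d))
        ≈⟨ +-congˡ (*-congˡ (+-congˡ (-‿cong (*-cong 2Nab≈1 (proj₂ reciprocal-D))))) ⟩
      V * t′ + s i + W * δ * (1ᴿ - 1ᴿ * 1ᴿ)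
        ≈⟨ solve 2 (λ x y → x :+ y :* (con (+ 1) :- con (+ 1) :* con (+ 1)) := x)
             refl (V * t′ + s i) (W * δ) ⟩
      V * t′ + s i ∎
      where
      V = fromℤ (v i)
      W = fromℤ (w i)
      E≈ : fromℤ (E i) ≈ fromℕ N * fromℕ D * W + fromℤ c * V
      E≈ = trans (fromℤ-+ (+ N ℤ.* + D ℤ.* w i) (c ℤ.* v i))
        (+-cong (trans (fromℤ-* (+ N ℤ.* + D) (w i)) (*-congʳ (fromℤ-* (+ N) (+ D))))
          (fromℤ-* c (v i)))

  lift-LRC : ∀ m N D → 1 ℕ.≤ m → 2 ℕ.* N ≡ suc m ℕ.* suc (suc m) → D ≢ 0 → sLRC (suc m) →
    (v w : Fin (suc m) → ℤ) (c : ℤ) →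
    (∀ i → + N ℤ.* + D ℤ.* w i ℤ.+ c ℤ.* v i ℤ.≤ + D) →
    (∀ i → ℤ.- + D ℤ.≤ + N ℤ.* + D ℤ.* w i ℤ.+ c ℤ.* v i) →
    LonelyDirection v w → sLRCForVelocities (λ i → fromℤ (v i))
  lift-LRC m N D 1≤m 2N≡ D≢0 slrc v w c E≤D -D≤E dir s =
    let t , r , far   = two-dimensional m 1≤m slrc v w dir s
        ρ , δ-bound   = nearest-half r
        t′ , far′     = round-time m N D 2N≡ D≢0 v w c s E≤D -D≤E t r ρ δ-bound far
    in t′ , λ i → Far⇒≤‖‖ (fromℤ (v i) * t′ + s i) (far′ i)

-- Lonely vectors with integer coordinates

ι : ℤ → ℚ
ι i = i ℚ./ 1

ι-injective : ∀ {i j} → ι i ≡ ι j → i ≡ j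
ι-injective {i} {j} eq with ℚᵘ.*≡* eq′ ← ℚ.fromℚᵘ-injective {ℚᵘ.mkℚᵘ i 0} {ℚᵘ.mkℚᵘ j 0} eq =
  ≡.trans (≡.sym (ℤ.*-identityʳ i)) (≡.trans eq′ (ℤ.*-identityʳ j))

toℚᵘ-ι : ∀ i → ℚ.toℚᵘ (ι i) ℚᵘ.≃ ℚᵘ.mkℚᵘ i 0
toℚᵘ-ι i = ℚ.toℚᵘ-fromℚᵘ (ℚᵘ.mkℚᵘ i 0)

ι-+ : ∀ i j → ι i ℚ.+ ι j ≡ ι (i ℤ.+ j)
ι-+ i j = ℚ.toℚᵘ-injective (begin
  ℚ.toℚᵘ (ι i ℚ.+ ι j)                  ≈⟨ ℚ.toℚᵘ-homo-+ (ι i) (ι j) ⟩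
  ℚ.toℚᵘ (ι i) ℚᵘ.+ ℚ.toℚᵘ (ι j)        ≈⟨ ℚᵘ.+-cong (toℚᵘ-ι i) (toℚᵘ-ι j) ⟩
  ℚᵘ.mkℚᵘ i 0 ℚᵘ.+ ℚᵘ.mkℚᵘ j 0
    ≈⟨ ℚᵘ.*≡* (≡.cong (ℤ._* + 1) (≡.cong₂ ℤ._+_ (ℤ.*-identityʳ i) (ℤ.*-identityʳ j))) ⟩
  ℚᵘ.mkℚᵘ (i ℤ.+ j) 0                           ≈⟨ toℚᵘ-ι (i ℤ.+ j) ⟨
  ℚ.toℚᵘ (ι (i ℤ.+ j))                      ∎)
  where open import Relation.Binary.Reasoning.Setoid ℚᵘ.≃-setoid

ι-* : ∀ i j → ι i ℚ.* ι j ≡ ι (i ℤ.* j)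
ι-* i j = ℚ.toℚᵘ-injective (begin
  ℚ.toℚᵘ (ι i ℚ.* ι j)                  ≈⟨ ℚ.toℚᵘ-homo-* (ι i) (ι j) ⟩
  ℚ.toℚᵘ (ι i) ℚᵘ.* ℚ.toℚᵘ (ι j)        ≈⟨ ℚᵘ.*-cong (toℚᵘ-ι i) (toℚᵘ-ι j) ⟩
  ℚᵘ.mkℚᵘ (i ℤ.* j) 0                           ≈⟨ toℚᵘ-ι (i ℤ.* j) ⟨
  ℚ.toℚᵘ (ι (i ℤ.* j))                      ∎)
  where open import Relation.Binary.Reasoning.Setoid ℚᵘ.≃-setoid

ι-neg : ∀ i → ℚ.- ι i ≡ ι (ℤ.- i)
ι-neg i = ℚ.toℚᵘ-injective (begin
  ℚ.toℚᵘ (ℚ.- ι i)       ≈⟨ ℚ.toℚᵘ-homo‿- (ι i) ⟩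
  ℚᵘ.- ℚ.toℚᵘ (ι i)      ≈⟨ ℚᵘ.-‿cong (toℚᵘ-ι i) ⟩
  ℚᵘ.mkℚᵘ (ℤ.- i) 0          ≈⟨ toℚᵘ-ι (ℤ.- i) ⟨
  ℚ.toℚᵘ (ι (ℤ.- i))     ∎)
  where open import Relation.Binary.Reasoning.Setoid ℚᵘ.≃-setoid

ι-- : ∀ i j → ι i ℚ.- ι j ≡ ι (i ℤ.- j)
ι-- i j = ≡.trans (≡.cong (ι i ℚ.+_) (ι-neg j)) (ι-+ i (ℤ.- j))

ι² : ℤ × ℤ → ℚ²
ι² (a , b) = ι a , ι b

cross≡0⇒∥ : ∀ a b c d → c ≢ + 0 → a ℤ.* d ≡ b ℤ.* c → ι² (a , b) ∥ ι² (c , d)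
cross≡0⇒∥ a b c d c≢0 ad≡bc = r , ≡.cong₂ _,_
  (begin
    ι a                               ≡⟨ ℚ.*-identityʳ (ι a) ⟨
    ι a ℚ.* ℚ.1ℚ                      ≡⟨ ≡.cong (ι a ℚ.*_) (ℚ.*-inverseˡ (ι c)) ⟨
    ι a ℚ.* (ℚ.1/ ι c ℚ.* ι c) ≡⟨ ℚ.*-assoc (ι a) (ℚ.1/ ι c) (ι c) ⟨
    r ℚ.* ι c                         ∎)
  (begin
    ι b                               ≡⟨ ℚ.*-identityʳ (ι b) ⟨
    ι b ℚ.* ℚ.1ℚ                      ≡⟨ ≡.cong (ι b ℚ.*_) (ℚ.*-inverseʳ (ι c)) ⟨
    ι b ℚ.* (ι c ℚ.* ℚ.1/ ι c) ≡⟨ ℚ.*-assoc (ι b) (ι c) (ℚ.1/ ι c) ⟨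
    ι b ℚ.* ι c ℚ.* ℚ.1/ ι c
      ≡⟨ ≡.cong (ℚ._* ℚ.1/ ι c) (≡.trans (ι-* b c)
           (≡.trans (≡.cong ι (≡.sym ad≡bc)) (≡.sym (ι-* a d)))) ⟩
    ι a ℚ.* ι d ℚ.* ℚ.1/ ι c  ≡⟨ ℚ.*-assoc (ι a) (ι d) (ℚ.1/ ι c) ⟩
    ι a ℚ.* (ι d ℚ.* ℚ.1/ ι c) ≡⟨ ≡.cong (ι a ℚ.*_) (ℚ.*-comm (ι d) (ℚ.1/ ι c)) ⟩
    ι a ℚ.* (ℚ.1/ ι c ℚ.* ι d) ≡⟨ ℚ.*-assoc (ι a) (ℚ.1/ ι c) (ι d) ⟨
    r ℚ.* ι d                         ∎)
  where
  open ≡.≡-Reasoning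
  instance
    nonZero : ℚ.NonZero (ι c)
    nonZero = ℚ.≢-nonZero (c≢0 ∘ ι-injective)
  r : ℚ
  r = ι a ℚ.* ℚ.1/ ι c

∥⇒cross≡0 : ∀ a b c d → ι² (a , b) ∥ ι² (c , d) → a ℤ.* d ≡ b ℤ.* c
∥⇒cross≡0 a b c d (r , eq) = ι-injective (begin
  ι (a ℤ.* d)                  ≡⟨ ι-* a d ⟨
  ι a ℚ.* ι d              ≡⟨ ≡.cong (ℚ._* ι d) (≡.cong proj₁ eq) ⟩
  r ℚ.* ι c ℚ.* ι d        ≡⟨ ℚ.*-assoc r (ι c) (ι d) ⟩
  r ℚ.* (ι c ℚ.* ι d)      ≡⟨ ≡.cong (r ℚ.*_) (ℚ.*-comm (ι c) (ι d)) ⟩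
  r ℚ.* (ι d ℚ.* ι c)      ≡⟨ ℚ.*-assoc r (ι d) (ι c) ⟨
  r ℚ.* ι d ℚ.* ι c        ≡⟨ ≡.cong (ℚ._* ι c) (≡.cong proj₂ eq) ⟨
  ι b ℚ.* ι c              ≡⟨ ι-* b c ⟩
  ι (b ℤ.* c)                  ∎)
  where open ≡.≡-Reasoning

-- Projecting along a lonely vector

∣i∣≡∣j∣⇒i≡±j : ∀ i j → ℤ.∣ i ∣ ≡ ℤ.∣ j ∣ → i ≡ j ⊎ i ≡ ℤ.- j
∣i∣≡∣j∣⇒i≡±j (+ m)    (+ m)    ≡.refl = inj₁ ≡.refl
∣i∣≡∣j∣⇒i≡±j (+ _)    -[1+ n ] ≡.refl = inj₂ ≡.refl
∣i∣≡∣j∣⇒i≡±j -[1+ m ] (+ _)    ≡.refl = inj₂ ≡.refl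
∣i∣≡∣j∣⇒i≡±j -[1+ m ] -[1+ m ] ≡.refl = inj₁ ≡.refl

module Cross where
  open ℤ.+-*-Solver

  -- This is the determinant of (c , d) and (a , b). It is spelled with `ℤ.- a` so that it agrees by
  -- computation with `speed` for α = b and β = -a.
  cross : ℤ → ℤ → ℤ → ℤ → ℤ
  cross c d a b = c ℤ.* b ℤ.+ d ℤ.* ℤ.- a

  cross≡0⇒ : ∀ a b c d → cross c d a b ≡ + 0 → a ℤ.* d ≡ b ℤ.* c
  cross≡0⇒ a b c d eq = ≡.sym (ℤ.i-j≡0⇒i≡j (b ℤ.* c) (a ℤ.* d) (≡.trans
    (solve 4 (λ a b c d → b :* c :- a :* d := c :* b :+ d :* (:- a)) ≡.refl a b c d) eq))

  cross-- : ∀ a b c d c′ d′ → cross (c ℤ.- c′) (d ℤ.- d′) a b ≡ cross c d a b ℤ.- cross c′ d′ a b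
  cross-- = solve 6 (λ a b c d c′ d′ → (c :- c′) :* b :+ (d :- d′) :* (:- a)
                  := c :* b :+ d :* (:- a) :- (c′ :* b :+ d′ :* (:- a))) ≡.refl

  cross-+ : ∀ a b c d c′ d′ →
            cross (c ℤ.+ c′) (d ℤ.+ d′) a b ≡ cross c d a b ℤ.- ℤ.- cross c′ d′ a b
  cross-+ = solve 6 (λ a b c d c′ d′ → (c :+ c′) :* b :+ (d :+ d′) :* (:- a)
                  := c :* b :+ d :* (:- a) :- (:- (c′ :* b :+ d′ :* (:- a)))) ≡.refl

  cross-self : ∀ a b → cross a b a b ≡ + 0
  cross-self = solve 2 (λ a b → a :* b :+ b :* (:- a) := con (+ 0)) ≡.refl

  cross-sum : ∀ a b c d → cross a b (a ℤ.+ c) (b ℤ.+ d) ≡ ℤ.- cross c d (a ℤ.+ c) (b ℤ.+ d)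
  cross-sum = solve 4 (λ a b c d → a :* (b :+ d) :+ b :* (:- (a :+ c))
                    := :- (c :* (b :+ d) :+ d :* (:- (a :+ c)))) ≡.refl

  cross-difference : ∀ a b c d → cross a b (a ℤ.- c) (b ℤ.- d) ≡ cross c d (a ℤ.- c) (b ℤ.- d)
  cross-difference = solve 4 (λ a b c d → a :* (b :- d) :+ b :* (:- (a :- c))
                    := c :* (b :- d) :+ d :* (:- (a :- c))) ≡.refl

module IntegerVectors {n} (v : Fin n → ℕ) (w : Fin n → ℤ) where

  V : Fin n → ℤ
  V i = + v i

  Sℤ : Index n → ℤ × ℤ
  Sℤ (single i)    = V i , w i
  Sℤ (plus i j _)  = V i ℤ.+ V j , w i ℤ.+ w j
  Sℤ (minus i j _) = V i ℤ.- V j , w i ℤ.- w j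

  Lonely : Index n → Set
  Lonely x = ∀ y → y ≢ x → proj₁ (Sℤ x) ℤ.* proj₂ (Sℤ y) ≢ proj₂ (Sℤ x) ℤ.* proj₁ (Sℤ y)

  p : Fin n → ℚ²
  p i = ι² (V i , w i)

  S≡ι² : ∀ x → S p x ≡ ι² (Sℤ x)
  S≡ι² (single i)    = ≡.refl
  S≡ι² (plus i j _)  = ≡.cong₂ _,_ (ι-+ (V i) (V j)) (ι-+ (w i) (w j))
  S≡ι² (minus i j _) = ≡.cong₂ _,_ (ι-- (V i) (V j)) (ι-- (w i) (w j))

  module _ (v>0 : ∀ i → 0 ℕ.< v i) (v-injective : Injective _≡_ _≡_ v) where

    V≢0 : ∀ i → V i ≢ + 0
    V≢0 i eq = ℕ.<⇒≢ (v>0 i) (≡.sym (ℤ.+-injective eq))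

    V+V≢0 : ∀ i j → V i ℤ.+ V j ≢ + 0
    V+V≢0 i j eq = V≢0 i (≡.cong +_ (ℕ.m+n≡0⇒m≡0 (v i) (ℤ.+-injective eq)))

    V-V≢0 : ∀ i j → i ≢ j → V i ℤ.- V j ≢ + 0
    V-V≢0 i j i≢j eq = i≢j (v-injective (ℤ.+-injective (ℤ.i-j≡0⇒i≡j (V i) (V j) eq)))

    -- Positive and pairwise distinct velocities make every first coordinate non-zero, so one can
    -- divide by it: a vanishing determinant then yields the multiplier that `_∥_` asks for.
    Sℤ₁≢0 : ∀ x → proj₁ (Sℤ x) ≢ + 0
    Sℤ₁≢0 (single i)      = V≢0 i
    Sℤ₁≢0 (plus i j _)    = V+V≢0 i j
    Sℤ₁≢0 (minus i j i<j) = V-V≢0 i j λ i≡j → contradiction-irr i<j (Fin.<-irrefl i≡j)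

    lonely-cross : LVP n → ¬ (∀ i j → V i ℤ.* w j ≡ w i ℤ.* V j) → ∃ Lonely
    lonely-cross lvp ¬∥ = map₂ (λ {x} lonely y y≢x eq → lonely y y≢x
        (≡.subst₂ _∥_ (≡.sym (S≡ι² x)) (≡.sym (S≡ι² y))
          (cross≡0⇒∥ (proj₁ (Sℤ x)) (proj₂ (Sℤ x)) (proj₁ (Sℤ y)) (proj₂ (Sℤ y)) (Sℤ₁≢0 y) eq)))
      (lvp p p≢𝟎 (λ ∥ → ¬∥ λ i j → ∥⇒cross≡0 (V i) (w i) (V j) (w j) (∥ i j))
        (λ i j i≢j → p≢p i≢j , p≢⊝p i j))
      where
      p≢𝟎 : ∀ i → p i ≢ 𝟎
      p≢𝟎 i eq = V≢0 i (ι-injective (≡.cong proj₁ eq))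

      p≢p : ∀ {i j} → i ≢ j → p i ≢ p j
      p≢p i≢j eq = i≢j (v-injective (ℤ.+-injective (ι-injective (≡.cong proj₁ eq))))

      p≢⊝p : ∀ i j → p i ≢ ⊝ p j
      p≢⊝p i j eq = V+V≢0 i j (ι-injective (≡.trans (≡.sym (ι-+ (V i) (V j)))
        (≡.trans (≡.cong (ℚ._+ ι (V j)) (≡.cong proj₁ eq)) (ℚ.+-inverseˡ (ι (V j))))))

    -- The runner to be set aside. For a sum or difference it is the first of the two indices; the
    -- second stays among the others, as the partner to which the first is tied.
    mentions : Index n → Fin n
    mentions (single i)    = i
    mentions (plus i _ _)  = i
    mentions (minus i _ _) = i

    lonelyDirection : LVP n → ¬ (∀ i j → V i ℤ.* w j ≡ w i ℤ.* V j) → LonelyDirection V w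
    lonelyDirection lvp ¬∥ = fromLonely (lonely-cross lvp ¬∥)
      where
      open Cross

      module _ (x : Index n) (lonely : Lonely x) where
        a = proj₁ (Sℤ x)
        b = proj₂ (Sℤ x)
        i₀ = mentions x

        speed : Fin n → ℤ
        speed i = cross (V i) (w i) a b

        -- Equal absolute values would make pᵢ - pⱼ or pᵢ + pⱼ parallel to the lonely vector. That
        -- member has another index than `x`, because its first runner is i and that of `x` is `i₀`.
        distinct< : ∀ i j → i ≢ i₀ → i Fin.< j → ℤ.∣ speed i ∣ ≢ ℤ.∣ speed j ∣
        distinct< i j i≢i₀ i<j eq with ∣i∣≡∣j∣⇒i≡±j (speed i) (speed j) eq
        ... | inj₁ s≡s = lonely (minus i j i<j) (λ { ≡.refl → i≢i₀ ≡.refl })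
          (cross≡0⇒ a b (V i ℤ.- V j) (w i ℤ.- w j)
            (≡.trans (cross-- a b (V i) (w i) (V j) (w j)) (ℤ.i≡j⇒i-j≡0 {speed i} {speed j} s≡s)))
        ... | inj₂ s≡-s = lonely (plus i j i<j) (λ { ≡.refl → i≢i₀ ≡.refl })
          (cross≡0⇒ a b (V i ℤ.+ V j) (w i ℤ.+ w j)
            (≡.trans (cross-+ a b (V i) (w i) (V j) (w j))
              (ℤ.i≡j⇒i-j≡0 {speed i} {ℤ.- speed j} s≡-s)))

        distinct : ∀ i j → i ≢ i₀ → j ≢ i₀ → i ≢ j → ℤ.∣ speed i ∣ ≢ ℤ.∣ speed j ∣
        distinct i j i≢i₀ j≢i₀ i≢j eq with Fin.<-cmp i j
        ... | tri< i<j _ _ = distinct< i j i≢i₀ i<j eq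
        ... | tri≈ _ i≡j _ = i≢j i≡j
        ... | tri> _ _ j<i = distinct< j i j≢i₀ j<i (≡.sym eq)

        nonzero : ∀ i → i ≢ i₀ → speed i ≢ + 0
        nonzero i i≢i₀ eq = lonely (single i) (λ { ≡.refl → i≢i₀ ≡.refl })
          (cross≡0⇒ a b (V i) (w i) eq)

      -- The projection along pᵢ kills pᵢ; along pᵢ - pⱼ it identifies pᵢ with pⱼ, and along pᵢ + pⱼ
      -- it identifies pᵢ with -pⱼ.
      tie : ∀ x → Tie V (λ i → cross (V i) (w i) (proj₁ (Sℤ x)) (proj₂ (Sℤ x))) (mentions x)
      tie (single i) = still (V≢0 i) (cross-self (V i) (w i))
      tie (plus i j i<j) =
        opposite j (λ j≡i → contradiction-irr i<j (Fin.<-irrefl (≡.sym j≡i))) (V+V≢0 i j)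
          (cross-sum (V i) (w i) (V j) (w j))
      tie (minus i j i<j) =
        same j (λ j≡i → contradiction-irr i<j (Fin.<-irrefl (≡.sym j≡i)))
          (V-V≢0 i j λ i≡j → contradiction-irr i<j (Fin.<-irrefl i≡j))
          (cross-difference (V i) (w i) (V j) (w j))

      fromLonely : ∃ Lonely → LonelyDirection V w
      fromLonely (x , lonely) = record
        { α = proj₂ (Sℤ x)
        ; β = ℤ.- proj₁ (Sℤ x)
        ; i₀ = mentions x
        ; tie = tie x
        ; speed≢0 = nonzero x lonely
        ; speed-distinct = distinct x lonely
        }

-- Counting the lattice points

foldr-gcd-∣ : ∀ {x xs} → x List.∈ xs → foldr gcd 0 xs ℕ.∣ x
foldr-gcd-∣ {x} {y ∷ xs} (here ≡.refl) = gcd[m,n]∣m y _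
foldr-gcd-∣ {x} {y ∷ xs} (there x∈xs)  = ℕ.∣-trans (gcd[m,n]∣n y _) (foldr-gcd-∣ x∈xs)

-- Multiplication by c distributes over gcd. Carrying c along is what later turns gcd 1 into
-- cancellation of v from d ∣ c vᵢ.
∣-foldr-gcd : ∀ {d} c {xs} → All (λ x → d ℕ.∣ c ℕ.* x) xs → d ℕ.∣ c ℕ.* foldr gcd 0 xs
∣-foldr-gcd {d} c []                    = ≡.subst (d ℕ.∣_) (≡.sym (ℕ.*-zeroʳ c)) (d ℕ.∣0)
∣-foldr-gcd {d} c {x ∷ xs} (d∣cx ∷ all) =
  ≡.subst (d ℕ.∣_) (≡.sym (c*gcd[m,n]≡gcd[cm,cn] c x _))
    (gcd-greatest d∣cx (∣-foldr-gcd c all))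

gcdOver-∣ : ∀ {n} (v : Fin n → ℕ) {T i} → i ∈ T → gcdOver v T ℕ.∣ v i
gcdOver-∣ v {T} {i} i∈T = foldr-gcd-∣ (∈-map⁺ v (∈-filter⁺ (_∈? T) (∈-allFin i) i∈T))

-- The empty subset has gcd 0 and so contributes no lattice point; for every other T there is a
-- facet through which the line leaves the cube.
gcdOver≢0⇒nonempty : ∀ {n} (v : Fin n → ℕ) T → gcdOver v T ≢ 0 → ∃ (_∈ T)
gcdOver≢0⇒nonempty {n} v T g≢0 = decidable-stable (Fin.any? (_∈? T)) λ empty →
  g≢0 (≡.cong (foldr gcd 0 ∘ map v)
    (filter-none (_∈? T) {allFin n} (universal (λ i i∈T → empty (i , i∈T)) (allFin n))))

coprime-∣ : ∀ {n} (v : Fin n → ℕ) → gcdOver v ⊤ ≡ 1 →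
            ∀ {d} c → (∀ i → d ℕ.∣ c ℕ.* v i) → d ℕ.∣ c
coprime-∣ {n} v g≡1 {d} c d∣cv = ≡.subst (d ℕ.∣_) (≡.trans (≡.cong (c ℕ.*_) g≡1) (ℕ.*-identityʳ c))
  (∣-foldr-gcd c (All.map⁺ (universal d∣cv (filter (_∈? ⊤) (allFin n)))))

subsets-unique : ∀ n → Unique (subsets n)
subsets-unique zero    = [] ∷ []
subsets-unique (suc n) = Unique.++⁺
  (Unique.map⁺ Vec.∷-injectiveʳ (subsets-unique n))
  (Unique.map⁺ Vec.∷-injectiveʳ (subsets-unique n))
  λ (T∈out , T∈in) → disjoint (∈-map⁻ _ T∈out) (∈-map⁻ _ T∈in)
  where
  disjoint : ∀ {T : Subset (suc n)} →
             (∃ λ U → U List.∈ subsets n × T ≡ outside Vec.∷ U) →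
             ¬ (∃ λ U → U List.∈ subsets n × T ≡ inside Vec.∷ U)
  disjoint (_ , _ , ≡.refl) (_ , _ , ())

module _ {A : Set} (f : A → ℕ) where

  decode : ∀ xs → Fin (sum (map f xs)) → Σ A (Fin ∘ f)
  decode (x ∷ xs) k with Fin.splitAt (f x) k
  ... | inj₁ j = x , j
  ... | inj₂ k = decode xs k

  decode-∈ : ∀ xs k → proj₁ (decode xs k) List.∈ xs
  decode-∈ (x ∷ xs) k with Fin.splitAt (f x) k
  ... | inj₁ j = here ≡.refl
  ... | inj₂ k = there (decode-∈ xs k)

  -- A pair decoded from the tail has its first component in the tail, where by uniqueness the head
  -- does not recur; so the two blocks cannot overlap.
  decode-injective : ∀ {xs} → Unique xs → ∀ k l → decode xs k ≡ decode xs l → k ≡ l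
  decode-injective {x ∷ xs} (x∉xs ∷ unique) k l eq
    with Fin.splitAt (f x) k in eqk | Fin.splitAt (f x) l in eql
  ... | inj₁ i | inj₁ j with ≡.refl ← eq =
    ≡.trans (≡.sym (Fin.splitAt⁻¹-↑ˡ {f x} eqk)) (Fin.splitAt⁻¹-↑ˡ {f x} eql)
  ... | inj₁ i | inj₂ j = contradiction
    (≡.subst (λ y → proj₁ y List.∈ xs) (≡.sym eq) (decode-∈ xs j)) (All.All¬⇒¬Any x∉xs)
  ... | inj₂ i | inj₁ j = contradiction
    (≡.subst (λ y → proj₁ y List.∈ xs) eq (decode-∈ xs i)) (All.All¬⇒¬Any x∉xs)
  ... | inj₂ i | inj₂ j = ≡.trans (≡.sym (Fin.splitAt⁻¹-↑ʳ {f x} eqk))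
    (≡.trans (≡.cong (f x Fin.↑ʳ_) (decode-injective unique i j eq)) (Fin.splitAt⁻¹-↑ʳ {f x} eql))

-- Lattice points whose lines meet the cube

module LatticePoints {n} (v : Fin n → ℕ) (v>0 : ∀ i → 0 ℕ.< v i) where

  g : Subset n → ℕ
  g = gcdOver v

  Vertex : Set
  Vertex = Σ (Subset n) (Fin ∘ g)

  -- z + (j / g T) vᵢ lies in [0,1], and ties between 0 and 1 are resolved so that
  -- it is 1 exactly when i ∈ T; r is its value scaled by g T.
  record Coordinate (T : Subset n) (j : ℕ) (i : Fin n) : Set where
    constructor coordinate
    field
      z     : ℤ
      r     : ℕ
      z≡    : z ℤ.* + g T ℤ.+ + j ℤ.* + v i ≡ + r
      r≤g   : r ℕ.≤ g T
      ∈⇒r≡g : i ∈ T → r ≡ g T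
      ∉⇒r<g : i ∉ T → r ℕ.< g T

  -- For i ∈ T the number j vᵢ / g T is an integer, and z is 1 minus it, so that the coordinate is 1
  -- at the exit time. Otherwise z is minus the floor of that quotient, and the scaled coordinate is
  -- the remainder, below g T.
  coordinateAt : ∀ T (j : Fin (g T)) i → Coordinate T (toℕ j) i
  coordinateAt T j i with i ∈? T
  ... | yes i∈T with divides q v≡q*g ← gcdOver-∣ v i∈T = coordinate
    (+ 1 ℤ.- + toℕ j ℤ.* + q) (g T)
    (≡.trans (≡.cong (λ k → (+ 1 ℤ.- + toℕ j ℤ.* + q) ℤ.* + g T ℤ.+ + toℕ j ℤ.* k)
               (≡.trans (≡.cong +_ v≡q*g) (ℤ.pos-* q (g T))))
             (identity (+ toℕ j) (+ q) (+ g T)))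
    ℕ.≤-refl (λ _ → ≡.refl) (contradiction i∈T)
    where
    open ℤ.+-*-Solver
    identity : ∀ j q g → (+ 1 ℤ.- j ℤ.* q) ℤ.* g ℤ.+ j ℤ.* (q ℤ.* g) ≡ g
    identity = solve 3 (λ j q g → (con (+ 1) :- j :* q) :* g :+ j :* (q :* g) := g) ≡.refl
  ... | no  i∉T = coordinate
    (ℤ.- + (jv / g T)) (jv % g T)
    (≡.trans (≡.cong (λ k → ℤ.- + (jv / g T) ℤ.* + g T ℤ.+ k) jv≡)
      (identity (+ (jv / g T)) (+ g T) (+ (jv % g T))))
    (ℕ.<⇒≤ (m%n<n jv (g T))) (λ i∈T → contradiction i∈T i∉T) (λ _ → m%n<n jv (g T))
    where
    instance
      _ : NonZero (g T)
      _ = Fin.nonZeroIndex j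
    jv = toℕ j ℕ.* v i
    jv≡ : + toℕ j ℤ.* + v i ≡ + (jv % g T) ℤ.+ + (jv / g T) ℤ.* + g T
    jv≡ = ≡.trans (≡.sym (ℤ.pos-* (toℕ j) (v i))) (≡.trans (≡.cong +_ (m≡m%n+[m/n]*n jv (g T)))
      (≡.cong (λ k → + (jv % g T) ℤ.+ k) (ℤ.pos-* (jv / g T) (g T))))
    open ℤ.+-*-Solver
    identity : ∀ q g r → ℤ.- q ℤ.* g ℤ.+ (r ℤ.+ q ℤ.* g) ≡ r
    identity = solve 3 (λ q g r → (:- q) :* g :+ (r :+ q :* g) := r) ≡.refl

  module At (x : Vertex) where
    T = proj₁ x
    G = g T
    J = toℕ (proj₂ x)

    J<G : J ℕ.< G
    J<G = Fin.toℕ<n (proj₂ x)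

    instance
      G-nonZero : NonZero G
      G-nonZero = Fin.nonZeroIndex (proj₂ x)

    private module C i = Coordinate (coordinateAt T (proj₂ x) i)
    open C public

    nonempty : ∃ (_∈ T)
    nonempty = gcdOver≢0⇒nonempty v T (ℕ.m<n⇒n≢0 J<G)

  private
    V : Fin n → ℤ
    V i = + v i

    module Identities where
      open ℤ.+-*-Solver

      gap : ∀ z′ k V G G′ J J′ →
            G′ ℤ.* ((z′ ℤ.+ k ℤ.* V) ℤ.* G ℤ.+ J ℤ.* V) ℤ.- G ℤ.* (z′ ℤ.* G′ ℤ.+ J′ ℤ.* V)
            ≡ (k ℤ.* G ℤ.+ J) ℤ.* G′ ℤ.* V ℤ.- G ℤ.* J′ ℤ.* V
      gap = solve 7 (λ z′ k V G G′ J J′ →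
        G′ :* ((z′ :+ k :* V) :* G :+ J :* V) :- G :* (z′ :* G′ :+ J′ :* V)
        := (k :* G :+ J) :* G′ :* V :- G :* J′ :* V) ≡.refl

      add-sub : ∀ z k V → z ≡ z ℤ.+ k ℤ.* V ℤ.+ ℤ.- k ℤ.* V
      add-sub = solve 3 (λ z k V → z := z :+ k :* V :+ (:- k) :* V) ≡.refl

      rescale : ∀ z V G G′ J J′ → G ℤ.* (z ℤ.* G′ ℤ.+ J′ ℤ.* V) ≡ z ℤ.* G ℤ.* G′ ℤ.+ G ℤ.* J′ ℤ.* V
      rescale = solve 6 (λ z V G G′ J J′ →
        G :* (z :* G′ :+ J′ :* V) := z :* G :* G′ :+ G :* J′ :* V) ≡.refl

      unscale : ∀ z V G G′ J → z ℤ.* G ℤ.* G′ ℤ.+ J ℤ.* G′ ℤ.* V ≡ G′ ℤ.* (z ℤ.* G ℤ.+ J ℤ.* V)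
      unscale = solve 5 (λ z V G G′ J →
        z :* G :* G′ :+ J :* G′ :* V := G′ :* (z :* G :+ J :* V)) ≡.refl

  module Shift (x x′ : Vertex) where
    private
      module X = At x
      module X′ = At x′

    -- J / G is the last time at which the line through z meets the cube, because
    -- T is non-empty; hence J′ / G′ ≤ k + J / G.
    later : ∀ k → (∀ i → X.z i ≡ X′.z i ℤ.+ k ℤ.* V i) →
            + X.G ℤ.* + X′.J ℤ.≤ (k ℤ.* + X.G ℤ.+ + X.J) ℤ.* + X′.G
    later k z≡z′+kv with i , i∈T ← X.nonempty =
      ℤ.*-cancelʳ-≤-pos _ _ (V i) {{ℤ.positive (ℤ.+<+ (v>0 i))}} (ℤ.0≤i-j⇒j≤i (begin
        ℤ.0ℤ
          ≤⟨ ℤ.i≤j⇒0≤j-i (ℤ.*-monoˡ-≤-nonNeg (+ X.G) (ℤ.+≤+ (X′.r≤g i))) ⟩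
        + X.G ℤ.* + X′.G ℤ.- + X.G ℤ.* + X′.r i
          ≡⟨ ≡.cong₂ ℤ._-_ (ℤ.*-comm (+ X.G) (+ X′.G))
               (≡.cong (λ r → + X.G ℤ.* r) (≡.sym (X′.z≡ i))) ⟩
        + X′.G ℤ.* + X.G ℤ.- + X.G ℤ.* (X′.z i ℤ.* + X′.G ℤ.+ + X′.J ℤ.* V i)
          ≡⟨ ≡.cong (λ r → + X′.G ℤ.* r ℤ.- + X.G ℤ.* (X′.z i ℤ.* + X′.G ℤ.+ + X′.J ℤ.* V i))
               (≡.sym (≡.trans (≡.cong (λ z → z ℤ.* + X.G ℤ.+ + X.J ℤ.* V i) (≡.sym (z≡z′+kv i)))
                 (≡.trans (X.z≡ i) (≡.cong +_ (X.∈⇒r≡g i i∈T))))) ⟩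
        _ ≡⟨ Identities.gap (X′.z i) k (V i) (+ X.G) (+ X′.G) (+ X.J) (+ X′.J) ⟩
        _ ∎))
      where open ℤ.≤-Reasoning

    -- Exit times lie in [0,1). From 0 ≤ J′ / G′ ≤ k + J / G < k + 1 follows k > -1.
    shift-nonneg : ∀ k → (∀ i → X.z i ≡ X′.z i ℤ.+ k ℤ.* V i) → ℤ.0ℤ ℤ.≤ k
    shift-nonneg k z≡z′+kv = ≡.subst (ℤ.0ℤ ℤ.≤_) (ℤ.pred-suc k)
      (ℤ.i<j⇒i≤pred[j] (ℤ.*-cancelʳ-<-nonNeg {ℤ.0ℤ} {ℤ.suc k} (+ X.G) (begin-strict
        ℤ.0ℤ                            ≤⟨ 0≤kG+J ⟩
        k ℤ.* + X.G ℤ.+ + X.J           <⟨ ℤ.+-monoʳ-< (k ℤ.* + X.G) (ℤ.+<+ X.J<G) ⟩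
        k ℤ.* + X.G ℤ.+ + X.G           ≡⟨ ℤ.+-comm (k ℤ.* + X.G) (+ X.G) ⟩
        + X.G ℤ.+ k ℤ.* + X.G           ≡⟨ ℤ.suc-* k (+ X.G) ⟨
        ℤ.suc k ℤ.* + X.G               ∎)))
      where
      open ℤ.≤-Reasoning
      0≤kG+J : ℤ.0ℤ ℤ.≤ k ℤ.* + X.G ℤ.+ + X.J
      0≤kG+J = ℤ.*-cancelʳ-≤-pos _ _ (+ X′.G) {{ℤ.positive (ℤ.+<+ (ℕ.≤-<-trans z≤n X′.J<G))}} (begin
        ℤ.0ℤ                                  ≤⟨ ℤ.+≤+ z≤n ⟩
        + (X.G ℕ.* X′.J)                      ≡⟨ ℤ.pos-* X.G X′.J ⟩
        + X.G ℤ.* + X′.J                      ≤⟨ later k z≡z′+kv ⟩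
        (k ℤ.* + X.G ℤ.+ + X.J) ℤ.* + X′.G    ∎)

    later₀ : (∀ i → X.z i ≡ X′.z i) → X.G ℕ.* X′.J ℕ.≤ X.J ℕ.* X′.G
    later₀ z≡z′ = ℤ.drop‿+≤+ (begin
      + (X.G ℕ.* X′.J)                        ≡⟨ ℤ.pos-* X.G X′.J ⟩
      + X.G ℤ.* + X′.J
        ≤⟨ later ℤ.0ℤ (λ i → ≡.trans (z≡z′ i) (≡.sym (ℤ.+-identityʳ _))) ⟩
      (ℤ.0ℤ ℤ.* + X.G ℤ.+ + X.J) ℤ.* + X′.G   ≡⟨ ≡.sym (ℤ.pos-* X.J X′.G) ⟩
      + (X.J ℕ.* X′.G)                        ∎)
      where open ℤ.≤-Reasoning

    -- The same z and the same exit time give the same exit point. Its i-th coordinate is 1 for i ∈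
    -- T, whereas i ∉ T′ would make it less than 1.
    T⊆T′ : (∀ i → X.z i ≡ X′.z i) → X.G ℕ.* X′.J ≡ X.J ℕ.* X′.G → X.T ⊆ X′.T
    T⊆T′ z≡z′ GJ′≡JG′ {i} i∈T = decidable-stable (i ∈? X′.T) λ i∉T′ →
      ℕ.<⇒≢ (X′.∉⇒r<g i i∉T′) (ℕ.*-cancelˡ-≡ (X′.r i) X′.G X.G (ℤ.+-injective (begin
        + (X.G ℕ.* X′.r i)                                     ≡⟨ ℤ.pos-* X.G (X′.r i) ⟩
        + X.G ℤ.* + X′.r i
          ≡⟨ ≡.cong (λ r → + X.G ℤ.* r) (X′.z≡ i) ⟨
        + X.G ℤ.* (X′.z i ℤ.* + X′.G ℤ.+ + X′.J ℤ.* V i)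
          ≡⟨ ≡.cong (λ z → + X.G ℤ.* (z ℤ.* + X′.G ℤ.+ + X′.J ℤ.* V i)) (z≡z′ i) ⟨
        + X.G ℤ.* (X.z i ℤ.* + X′.G ℤ.+ + X′.J ℤ.* V i)
          ≡⟨ Identities.rescale (X.z i) (V i) (+ X.G) (+ X′.G) (+ X.J) (+ X′.J) ⟩
        X.z i ℤ.* + X.G ℤ.* + X′.G ℤ.+ + X.G ℤ.* + X′.J ℤ.* V i
          ≡⟨ ≡.cong (λ p → X.z i ℤ.* + X.G ℤ.* + X′.G ℤ.+ p ℤ.* V i) GJ′≡JG′ᶻ ⟩
        X.z i ℤ.* + X.G ℤ.* + X′.G ℤ.+ + X.J ℤ.* + X′.G ℤ.* V i
          ≡⟨ Identities.unscale (X.z i) (V i) (+ X.G) (+ X′.G) (+ X.J) ⟩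
        + X′.G ℤ.* (X.z i ℤ.* + X.G ℤ.+ + X.J ℤ.* V i)
          ≡⟨ ≡.cong (λ r → + X′.G ℤ.* r) (X.z≡ i) ⟩
        + X′.G ℤ.* + X.r i
          ≡⟨ ≡.cong (λ r → + X′.G ℤ.* + r) (X.∈⇒r≡g i i∈T) ⟩
        + X′.G ℤ.* + X.G                                       ≡⟨ ℤ.pos-* X′.G X.G ⟨
        + (X′.G ℕ.* X.G)                                       ≡⟨ ≡.cong +_ (ℕ.*-comm X′.G X.G) ⟩
        + (X.G ℕ.* X′.G)                                       ∎)))
      where
      open ≡.≡-Reasoning
      GJ′≡JG′ᶻ : + X.G ℤ.* + X′.J ≡ + X.J ℤ.* + X′.G
      GJ′≡JG′ᶻ = ≡.trans (≡.sym (ℤ.pos-* X.G X′.J)) (≡.trans (≡.cong +_ GJ′≡JG′) (ℤ.pos-* X.J X′.G))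

  -- Different pairs of a subset and an index give points that differ even modulo v. Comparing exit
  -- times both ways yields k = 0 and J / G = J′ / G′; then T = T′, hence G = G′ and J = J′.
  vertex-injective : ∀ x x′ k → (∀ i → At.z x i ≡ At.z x′ i ℤ.+ k ℤ.* V i) → x ≡ x′
  vertex-injective x x′ k z≡z′+kv = same-subset x x′ (⊆-antisym
      (Shift.T⊆T′ x x′ z≡z′ GJ′≡JG′)
      (Shift.T⊆T′ x′ x (≡.sym ∘ z≡z′)
        (≡.trans (ℕ.*-comm X′.G X.J) (≡.trans (≡.sym GJ′≡JG′) (ℕ.*-comm X.G X′.J)))))
    GJ′≡JG′
    where
    module X = At x
    module X′ = At x′
    0≤-k : ℤ.0ℤ ℤ.≤ ℤ.- k
    0≤-k = Shift.shift-nonneg x′ x (ℤ.- k) λ i → ≡.trans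
      (Identities.add-sub (X′.z i) k (V i)) (≡.cong (λ z → z ℤ.+ ℤ.- k ℤ.* V i) (≡.sym (z≡z′+kv i)))
    k≡0 : k ≡ ℤ.0ℤ
    k≡0 = ℤ.≤-antisym (ℤ.neg-cancel-≤ 0≤-k) (Shift.shift-nonneg x x′ k z≡z′+kv)
    z≡z′ : ∀ i → X.z i ≡ X′.z i
    z≡z′ i = ≡.trans (z≡z′+kv i)
      (≡.trans (≡.cong (λ k → X′.z i ℤ.+ k ℤ.* V i) k≡0) (ℤ.+-identityʳ _))
    GJ′≡JG′ : X.G ℕ.* X′.J ≡ X.J ℕ.* X′.G
    GJ′≡JG′ = ℕ.≤-antisym (Shift.later₀ x x′ z≡z′)
      (≡.subst₂ ℕ._≤_ (ℕ.*-comm X′.G X.J) (ℕ.*-comm X′.J X.G) (Shift.later₀ x′ x (≡.sym ∘ z≡z′)))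
    same-subset : ∀ x x′ → proj₁ x ≡ proj₁ x′ → At.G x ℕ.* At.J x′ ≡ At.J x ℕ.* At.G x′ → x ≡ x′
    same-subset (T , j) (.T , j′) ≡.refl eq = ≡.cong (T ,_) (Fin.toℕ-injective
      (ℕ.*-cancelʳ-≡ (toℕ j) (toℕ j′) (g T) {{Fin.nonZeroIndex j}}
        (≡.trans (≡.sym eq) (ℕ.*-comm (g T) (toℕ j′)))))

  -- ‖w + τ v‖∞ ≤ 1/N for τ = c / (N D), with denominators cleared.
  record ShortVector (N : ℕ) : Set where
    field
      w        : Fin n → ℤ
      c        : ℤ
      D        : ℕ
      D≢0      : D ≢ 0
      upper    : ∀ i → + N ℤ.* + D ℤ.* w i ℤ.+ c ℤ.* V i ℤ.≤ + D
      lower    : ∀ i → ℤ.- + D ℤ.≤ + N ℤ.* + D ℤ.* w i ℤ.+ c ℤ.* V i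
      ∦        : ¬ (∀ i j → V i ℤ.* w j ≡ w i ℤ.* V j)

  -- Short vectors from congruent points

  module Difference (N : ℕ) (x x′ : Vertex) (k k′ : ℤ) (w : Fin n → ℤ)
    (congruent : ∀ i → (At.z x i ℤ.+ k ℤ.* V i) ℤ.- (At.z x′ i ℤ.+ k′ ℤ.* V i) ≡ w i ℤ.* + N) where
    private
      module X = At x
      module X′ = At x′
    D : ℕ
    D = X.G ℕ.* X′.G
    -- Here c / D = k′ - k + J / G - J′ / G′, chosen so that N w + (c / D) v is the difference of
    -- the two exit points. Both lie in [0,1]ⁿ, so its coordinates lie in [-1,1].
    c : ℤ
    c = + X.G ℤ.* + X′.G ℤ.* (k′ ℤ.- k) ℤ.+ + X′.G ℤ.* + X.J ℤ.- + X.G ℤ.* + X′.J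

    D≢0 : D ≢ 0
    D≢0 D≡0 with ℕ.m*n≡0⇒m≡0∨n≡0 X.G D≡0
    ... | inj₁ G≡0 = ℕ.m<n⇒n≢0 X.J<G G≡0
    ... | inj₂ G′≡0 = ℕ.m<n⇒n≢0 X′.J<G G′≡0

    combination : ∀ i → + N ℤ.* + D ℤ.* w i ℤ.+ c ℤ.* V i
                        ≡ + (X′.G ℕ.* X.r i) ℤ.- + (X.G ℕ.* X′.r i)
    combination i = begin
      + N ℤ.* + D ℤ.* w i ℤ.+ c ℤ.* V i
        ≡⟨ ≡.cong (λ d → + N ℤ.* d ℤ.* w i ℤ.+ c ℤ.* V i) (ℤ.pos-* X.G X′.G) ⟩
      + N ℤ.* (+ X.G ℤ.* + X′.G) ℤ.* w i ℤ.+ c ℤ.* V i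
        ≡⟨ regroup (+ N) (w i) (+ X.G) (+ X′.G) (c ℤ.* V i) ⟩
      + X.G ℤ.* + X′.G ℤ.* (w i ℤ.* + N) ℤ.+ c ℤ.* V i
        ≡⟨ ≡.cong (λ d → + X.G ℤ.* + X′.G ℤ.* d ℤ.+ c ℤ.* V i) (congruent i) ⟨
      + X.G ℤ.* + X′.G ℤ.* ((X.z i ℤ.+ k ℤ.* V i) ℤ.- (X′.z i ℤ.+ k′ ℤ.* V i)) ℤ.+ c ℤ.* V i
        ≡⟨ cancel (X.z i) (X′.z i) (V i) (+ X.G) (+ X′.G) (+ X.J) (+ X′.J) k k′ ⟩
      + X′.G ℤ.* (X.z i ℤ.* + X.G ℤ.+ + X.J ℤ.* V i)
        ℤ.- + X.G ℤ.* (X′.z i ℤ.* + X′.G ℤ.+ + X′.J ℤ.* V i)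
        ≡⟨ ≡.cong₂ (λ r r′ → + X′.G ℤ.* r ℤ.- + X.G ℤ.* r′) (X.z≡ i) (X′.z≡ i) ⟩
      + X′.G ℤ.* + X.r i ℤ.- + X.G ℤ.* + X′.r i
        ≡⟨ ≡.cong₂ ℤ._-_ (ℤ.pos-* X′.G (X.r i)) (ℤ.pos-* X.G (X′.r i)) ⟨
      + (X′.G ℕ.* X.r i) ℤ.- + (X.G ℕ.* X′.r i) ∎
      where
      open ≡.≡-Reasoning
      open ℤ.+-*-Solver
      regroup : ∀ N w G G′ e → N ℤ.* (G ℤ.* G′) ℤ.* w ℤ.+ e ≡ G ℤ.* G′ ℤ.* (w ℤ.* N) ℤ.+ e
      regroup = solve 5 (λ N w G G′ e → N :* (G :* G′) :* w :+ e := G :* G′ :* (w :* N) :+ e) ≡.refl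
      cancel : ∀ z z′ V G G′ J J′ k k′ →
        G ℤ.* G′ ℤ.* ((z ℤ.+ k ℤ.* V) ℤ.- (z′ ℤ.+ k′ ℤ.* V))
          ℤ.+ (G ℤ.* G′ ℤ.* (k′ ℤ.- k) ℤ.+ G′ ℤ.* J ℤ.- G ℤ.* J′) ℤ.* V
        ≡ G′ ℤ.* (z ℤ.* G ℤ.+ J ℤ.* V) ℤ.- G ℤ.* (z′ ℤ.* G′ ℤ.+ J′ ℤ.* V)
      cancel = solve 9 (λ z z′ V G G′ J J′ k k′ →
        G :* G′ :* ((z :+ k :* V) :- (z′ :+ k′ :* V))
          :+ (G :* G′ :* (k′ :- k) :+ G′ :* J :- G :* J′) :* V
        := G′ :* (z :* G :+ J :* V) :- G :* (z′ :* G′ :+ J′ :* V)) ≡.refl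

    G′r≤D : ∀ i → X′.G ℕ.* X.r i ℕ.≤ D
    G′r≤D i = ≡.subst (X′.G ℕ.* X.r i ℕ.≤_) (ℕ.*-comm X′.G X.G) (ℕ.*-monoʳ-≤ X′.G (X.r≤g i))

    upper : ∀ i → + N ℤ.* + D ℤ.* w i ℤ.+ c ℤ.* V i ℤ.≤ + D
    upper i = ≡.subst (ℤ._≤ + D) (≡.sym (combination i))
      (ℤ.≤-trans (ℤ.i-j≤i (+ (X′.G ℕ.* X.r i)) (+ (X.G ℕ.* X′.r i))) (ℤ.+≤+ (G′r≤D i)))

    lower : ∀ i → ℤ.- + D ℤ.≤ + N ℤ.* + D ℤ.* w i ℤ.+ c ℤ.* V i
    lower i = ≡.subst (ℤ.- + D ℤ.≤_) (≡.sym (combination i))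
      (ℤ.≤-trans (ℤ.neg-mono-≤ (ℤ.+≤+ (ℕ.*-monoʳ-≤ X.G (X′.r≤g i))))
        (ℤ.i≤j+i (ℤ.- + (X.G ℕ.* X′.r i)) (+ (X′.G ℕ.* X.r i))))

  -- The vector v is primitive: its entry at `i₀` divides w i₀ times every entry of v, hence divides
  -- w i₀, and the quotient is the multiplier.
  ∥⇒multiple : gcdOver v ⊤ ≡ 1 → Fin n → (w : Fin n → ℤ) → (∀ i j → V i ℤ.* w j ≡ w i ℤ.* V j) →
               ∃ λ m → ∀ j → w j ≡ m ℤ.* V j
  ∥⇒multiple g≡1 i₀ w ∥ = quotient Vi₀∣wi₀
    where
    open ≡.≡-Reasoning
    Vi₀∣wi₀ : V i₀ ℤ.∣ w i₀
    Vi₀∣wi₀ = ℤ.∣ᵤ⇒∣ (coprime-∣ v g≡1 ℤ.∣ w i₀ ∣ λ j → divides ℤ.∣ w j ∣ (begin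
      ℤ.∣ w i₀ ∣ ℕ.* v j      ≡⟨ ℤ.abs-* (w i₀) (V j) ⟨
      ℤ.∣ w i₀ ℤ.* V j ∣      ≡⟨ ≡.cong ℤ.∣_∣ (∥ i₀ j) ⟨
      ℤ.∣ V i₀ ℤ.* w j ∣      ≡⟨ ℤ.abs-* (V i₀) (w j) ⟩
      v i₀ ℕ.* ℤ.∣ w j ∣      ≡⟨ ℕ.*-comm (v i₀) ℤ.∣ w j ∣ ⟩
      ℤ.∣ w j ∣ ℕ.* v i₀      ∎))
    quotient : V i₀ ℤ.∣ w i₀ → ∃ λ m → ∀ j → w j ≡ m ℤ.* V j
    quotient (ℤ.divides m wi₀≡mVi₀) = m , λ j →
      ℤ.*-cancelˡ-≡ (V i₀) (w j) (m ℤ.* V j) {{ℕ.>-nonZero (v>0 i₀)}} (begin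
        V i₀ ℤ.* w j             ≡⟨ ∥ i₀ j ⟩
        w i₀ ℤ.* V j             ≡⟨ ≡.cong (ℤ._* V j) (≡.trans wi₀≡mVi₀ (ℤ.*-comm m (V i₀))) ⟩
        V i₀ ℤ.* m ℤ.* V j       ≡⟨ ℤ.*-assoc (V i₀) m (V j) ⟩
        V i₀ ℤ.* (m ℤ.* V j)     ∎)

  -- Modulo N the primitive vector v has order exactly N, so the N translates of a point by
  -- multiples of v are pairwise incongruent.
  coprime-∣-difference : gcdOver v ⊤ ≡ 1 → ∀ {N} (k k′ : Fin N) (w : Fin n → ℤ) →
    (∀ i → (+ toℕ k ℤ.- + toℕ k′) ℤ.* V i ≡ w i ℤ.* + N) → k ≡ k′
  coprime-∣-difference g≡1 {N} k k′ w multiple = Fin.toℕ-injective (ℤ.+-injective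
    (ℤ.i-j≡0⇒i≡j (+ toℕ k) (+ toℕ k′) (ℤ.∣i∣≡0⇒i≡0 (small ℤ.∣ d ∣ ∣d∣<N N∣d))))
    where
    d = + toℕ k ℤ.- + toℕ k′
    N∣d : N ℕ.∣ ℤ.∣ d ∣
    N∣d = coprime-∣ v g≡1 ℤ.∣ d ∣ λ i → divides ℤ.∣ w i ∣
      (≡.trans (≡.sym (ℤ.abs-* d (V i)))
        (≡.trans (≡.cong ℤ.∣_∣ (multiple i)) (ℤ.abs-* (w i) (+ N))))
    ∣d∣<N : ℤ.∣ d ∣ ℕ.< N
    ∣d∣<N = ℕ.≤-<-trans
      (≡.subst (ℕ._≤ toℕ k ℕ.⊔ toℕ k′) (≡.cong ℤ.∣_∣ (≡.sym (ℤ.m-n≡m⊖n (toℕ k) (toℕ k′))))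
        (ℤ.∣m⊝n∣≤m⊔n (toℕ k) (toℕ k′)))
      (ℕ.⊔-lub (Fin.toℕ<n k) (Fin.toℕ<n k′))
    small : ∀ e → e ℕ.< N → N ℕ.∣ e → e ≡ 0
    small zero    _   _   = ≡.refl
    small (suc e) e<N N∣e = contradiction (ℕ.∣⇒≤ N∣e) (ℕ.<⇒≱ e<N)

  %ℕ≡⇒ : ∀ N .{{_ : NonZero N}} a b → a ℤ.%ℕ N ≡ b ℤ.%ℕ N →
          a ℤ.- b ≡ (a ℤ./ℕ N ℤ.- b ℤ./ℕ N) ℤ.* + N
  %ℕ≡⇒ N a b eq = begin
    a ℤ.- b
      ≡⟨ ≡.cong₂ ℤ._-_ (ℤ.a≡a%ℕn+[a/ℕn]*n a N)
           (≡.trans (ℤ.a≡a%ℕn+[a/ℕn]*n b N) (≡.cong (λ r → + r ℤ.+ b ℤ./ℕ N ℤ.* + N) (≡.sym eq))) ⟩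
    _             ≡⟨ identity (+ (a ℤ.%ℕ N)) (a ℤ./ℕ N) (b ℤ./ℕ N) (+ N) ⟩
    (a ℤ./ℕ N ℤ.- b ℤ./ℕ N) ℤ.* + N ∎
    where
    open ≡.≡-Reasoning
    open ℤ.+-*-Solver
    identity : ∀ r q q′ N → (r ℤ.+ q ℤ.* N) ℤ.- (r ℤ.+ q′ ℤ.* N) ≡ (q ℤ.- q′) ℤ.* N
    identity = solve 4 (λ r q q′ N → (r :+ q :* N) :- (r :+ q′ :* N) := (q :- q′) :* N) ≡.refl

  -- Instead of passing to the quotient by v, each of the M points is replaced by its N translates z
  -- + k v with 0 ≤ k < N. These M N points are compared with the N^n residue classes modulo N.
  module Pigeonhole (g≡1 : gcdOver v ⊤ ≡ 1) (N : ℕ) .{{_ : NonZero N}} where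
    M = sum (map g (subsets n))

    vertex : Fin (M ℕ.* N) → Vertex
    vertex x = decode g (subsets n) (Fin.quotient N x)

    offset : Fin (M ℕ.* N) → Fin N
    offset x = Fin.remainder {M} N x

    point : Fin (M ℕ.* N) → Fin n → ℤ
    point x i = At.z (vertex x) i ℤ.+ + toℕ (offset x) ℤ.* V i

    residues : Fin (M ℕ.* N) → Fin (N ℕ.^ n)
    residues x = Fin.funToFin (λ i → Fin.fromℕ< (ℤ.n%ℕd<d (point x i) N))

    residues-≡ : ∀ x y → residues x ≡ residues y → ∀ i → point x i ℤ.%ℕ N ≡ point y i ℤ.%ℕ N
    residues-≡ x y eq i = Fin.fromℕ<-injective _ _ _ _ (≡.trans (≡.sym (Fin.finToFun-funToFin _ i))
      (≡.trans (≡.cong (λ r → Fin.finToFun r i) eq) (Fin.finToFun-funToFin _ i)))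

    -- If w were parallel to v, say w = m v, then z and z′ would differ by (m N + k′ - k) v. The two
    -- vertices would agree, then also the offsets, contrary to x ≠ y.
    collision⇒short : ∀ x y → x ≢ y → residues x ≡ residues y → ShortVector N
    collision⇒short x y x≢y eq = record
      { w = w ; c = c ; D = D ; D≢0 = D≢0 ; upper = upper ; lower = lower ; ∦ = x≢y ∘ ∥⇒≡ }
      where
      w : Fin n → ℤ
      w i = point x i ℤ./ℕ N ℤ.- point y i ℤ./ℕ N
      k = + toℕ (offset x)
      k′ = + toℕ (offset y)
      congruent : ∀ i → point x i ℤ.- point y i ≡ w i ℤ.* + N
      congruent i = %ℕ≡⇒ N (point x i) (point y i) (residues-≡ x y eq i)
      open Difference N (vertex x) (vertex y) k k′ w congruent
      open ℤ.+-*-Solver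

      isolate : ∀ z z′ k k′ V m N → (z ℤ.+ k ℤ.* V) ℤ.- (z′ ℤ.+ k′ ℤ.* V) ≡ m ℤ.* V ℤ.* N →
                z ≡ z′ ℤ.+ (m ℤ.* N ℤ.+ k′ ℤ.- k) ℤ.* V
      isolate z z′ k k′ V m N eq = ≡.trans
        (solve 5 (λ z z′ k k′ V → z := ((z :+ k :* V) :- (z′ :+ k′ :* V)) :+ (z′ :+ (k′ :- k) :* V))
          ≡.refl z z′ k k′ V)
        (≡.trans (≡.cong (λ d → d ℤ.+ (z′ ℤ.+ (k′ ℤ.- k) ℤ.* V)) eq)
          (solve 6 (λ z′ k k′ V m N → m :* V :* N :+ (z′ :+ (k′ :- k) :* V)
                                      := z′ :+ (m :* N :+ k′ :- k) :* V)
            ≡.refl z′ k k′ V m N))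

      offsets : ∀ z k k′ V → (k ℤ.- k′) ℤ.* V ≡ (z ℤ.+ k ℤ.* V) ℤ.- (z ℤ.+ k′ ℤ.* V)
      offsets = solve 4 (λ z k k′ V → (k :- k′) :* V := (z :+ k :* V) :- (z :+ k′ :* V)) ≡.refl

      ∥⇒≡ : (∀ i j → V i ℤ.* w j ≡ w i ℤ.* V j) → x ≡ y
      ∥⇒≡ ∥ = ≡.trans (≡.sym (Fin.combine-remQuot {M} N x)) (≡.trans
          (≡.cong₂ Fin.combine (decode-injective g (subsets-unique n) _ _ vertex≡) offset≡)
          (Fin.combine-remQuot {M} N y))
        where
        multiple = ∥⇒multiple g≡1 (proj₁ (At.nonempty (vertex x))) w ∥
        m = proj₁ multiple
        vertex≡ : vertex x ≡ vertex y
        vertex≡ = vertex-injective (vertex x) (vertex y) (m ℤ.* + N ℤ.+ k′ ℤ.- k) λ i →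
          isolate (At.z (vertex x) i) (At.z (vertex y) i) k k′ (V i) m (+ N)
            (≡.trans (congruent i) (≡.cong (ℤ._* + N) (proj₂ multiple i)))
        offset≡ : offset x ≡ offset y
        offset≡ = coprime-∣-difference g≡1 (offset x) (offset y) w λ i →
          ≡.trans (offsets (At.z (vertex y) i) k k′ (V i))
            (≡.trans (≡.cong (λ X → (At.z X i ℤ.+ k ℤ.* V i) ℤ.- point y i) (≡.sym vertex≡))
              (congruent i))

    shortVector : N ℕ.^ n ℕ.< M ℕ.* N → ShortVector N
    shortVector N^n<MN with x , y , x<y , eq ← Fin.pigeonhole N^n<MN residues =
      collision⇒short x y (Fin.<⇒≢ x<y) eq

-- The value of C(n+1,2) and the combination of both halves

2*[1+n]C2≡n*[1+n] : ∀ n → 2 ℕ.* (suc n C 2) ≡ n ℕ.* suc n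
2*[1+n]C2≡n*[1+n] zero    = ≡.refl
2*[1+n]C2≡n*[1+n] (suc n) = begin
  2 ℕ.* (suc (suc n) C 2)
    ≡⟨ ≡.cong (2 ℕ.*_) (nCk+nC[k+1]≡[n+1]C[k+1] (suc n) 1) ⟨
  2 ℕ.* (suc n C 1 ℕ.+ suc n C 2)
    ≡⟨ ≡.cong (λ k → 2 ℕ.* (k ℕ.+ suc n C 2)) (nC1≡n (suc n)) ⟩
  2 ℕ.* (suc n ℕ.+ suc n C 2)                ≡⟨ ℕ.*-distribˡ-+ 2 (suc n) (suc n C 2) ⟩
  2 ℕ.* suc n ℕ.+ 2 ℕ.* (suc n C 2)          ≡⟨ ≡.cong (2 ℕ.* suc n ℕ.+_) (2*[1+n]C2≡n*[1+n] n) ⟩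
  2 ℕ.* suc n ℕ.+ n ℕ.* suc n                ≡⟨ ℕ.*-distribʳ-+ (suc n) 2 n ⟨
  suc (suc n) ℕ.* suc n                      ≡⟨ ℕ.*-comm (suc (suc n)) (suc n) ⟩
  suc n ℕ.* suc (suc n)                      ∎
  where open ≡.≡-Reasoning

-- A single vector is parallel to itself, so non-parallelism provides the n ≥ 2 on which the
-- position 1/2 of a tied runner depends.
not-all-parallel⇒1≤ : ∀ {m} (v w : Fin (suc m) → ℤ) →
                      ¬ (∀ i j → v i ℤ.* w j ≡ w i ℤ.* v j) → 1 ℕ.≤ m
not-all-parallel⇒1≤ {zero}  v w ∦ =
  contradiction (λ { Fin.zero Fin.zero → ℤ.*-comm (v Fin.zero) (w Fin.zero) }) ∦
not-all-parallel⇒1≤ {suc m} v w ∦ = s≤s z≤n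

open import Data.Nat.Base using (_≤_; _<_; _∸_; _^_)

theorem2 : (em : ExcludedMiddle 0ℓ) (R : CompleteOrderedField) →
    (n : ℕ) .{{_ : NonZero n}} →
    Real.sLRC em R n →
    (∀ k → k ≤ n → LVP k) →
    (v : Fin n → ℕ) →
    (∀ i → 0 < v i) →
    Injective _≡_ _≡_ v →
    gcdOver v ⊤ ≡ 1 →
    (suc n C 2) ^ (n ∸ 1) < sum (map (gcdOver v) (subsets n)) →
    Real.sLRCForVelocities em R (λ i → Real.fromℕ em R (v i))
-- For n = 0 the gcd is the empty one, which is 0 and not 1.
theorem2 em R zero    _    _   v _   _           ()
theorem2 em R (suc m) slrc lvp v v>0 v-injective g≡1 N^m<M =
  RealFacts.lift-LRC em R m N D (not-all-parallel⇒1≤ (λ i → + v i) w ∦) 2N≡ D≢0 slrc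
    (λ i → + v i) w c upper lower
    (IntegerVectors.lonelyDirection v w v>0 v-injective (lvp (suc m) ℕ.≤-refl) ∦)
  where
  N = suc (suc m) C 2
  2N≡ : 2 ℕ.* N ≡ suc m ℕ.* suc (suc m)
  2N≡ = 2*[1+n]C2≡n*[1+n] (suc m)
  instance
    N-nonZero : NonZero N
    N-nonZero = ℕ.≢-nonZero λ N≡0 → contradiction (≡.trans (≡.sym (≡.cong (2 ℕ.*_) N≡0)) 2N≡) λ ()
  -- The exponent `n ∸ 1` is m here; multiplying the bound by N > 0 keeps it strict and gives the
  -- count for the pigeonhole.
  N^n<MN : N ^ suc m < sum (map (gcdOver v) (subsets (suc m))) ℕ.* N
  N^n<MN = ≡.subst₂ _<_ (ℕ.*-comm (N ^ m) N) ≡.refl (ℕ.*-monoˡ-< N N^m<M)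
  open LatticePoints v v>0
  open ShortVector (Pigeonhole.shortVector g≡1 N N^n<MN)
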